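{- If an interaction system is strongly upward confluent, then each of its interaction rules is connected.
   Context: Interaction calculus. A signature $\Sigma$ is a set of agent types, each $\alpha\in\Sigma$ with an arity $\operatorname{ar}(\alpha)\ge 0$. Terms are given by $t ::= x \mid \alpha(t_1,\dots,t_n)$ with $x$ a name and $n=\operatorname{ar}(\alpha)$. An equation $t=u$ is an unordered pair of terms. A configuration $\langle \vec f \mid \Delta\rangle$ consists of a finite sequence of terms $\vec f$ (the interface) and a finite unordered multiset $\Delta$ of equations, where each name occurs at most twice in the whole configuration; configurations are considered up to $\alpha$-conversion (simultaneous renaming of both occurrences of a name to a name not otherwise occurring). An interaction rule is written $\alpha[v_1,\dots,v_m]\bowtie\beta[w_1,\dots,w_n]$ with $m=\operatorname{ar}(\alpha)$, $n=\operatorname{ar}(\beta)$ and $v_i,w_j$ terms in which each name of the rule occurs exactly twice; rules are taken up to renaming of names, $\alpha[\vec v]\bowtie\beta[\vec w]$ is the same rule as $\beta[\vec w]\bowtie\alpha[\vec v]$, and there is at most one rule for each unordered pair of agent types. An interaction system is a signature with a set of interaction rules. If $\alpha[v_1,\dots,v_m]\bowtie\beta[w_1,\dots,w_n]$ is a rule, then $\alpha(t_1,\dots,t_m)\div\beta(u_1,\dots,u_n)$ denotes the multiset of equations $\{t_1=v_1,\dots,t_m=v_m,\ u_1=w_1,\dots,u_n=w_n\}$, with the names of the rule chosen fresh. An interaction rule $\alpha[\vec v]\bowtie\beta[\vec w]$ is disconnected if and only if $\alpha(\vec x)\div\beta(\vec y)$, where $\vec x$ and $\vec y$ are (pairwise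 distinct) fresh names, can be split into some non-empty multisets $\Gamma$ and $\Delta$ such that no name occurs in both $\Gamma$ and $\Delta$; otherwise the rule is connected. Reduction $\rightarrow$ on configurations consists of two kinds of steps. Interaction: $\langle \vec f \mid \alpha(\vec t)=\beta(\vec u),\ \Delta\rangle \rightarrow \langle \vec f \mid \alpha(\vec t)\div\beta(\vec u),\ \Delta\rangle$ for a rule $\alpha[\vec v]\bowtie\beta[\vec w]$ of the system. Indirection: if a configuration contains an equation $x=u$ where the name $x$ does not occur in $u$ and has its other occurrence elsewhere (in the interface or in another equation), remove the equation $x=u$ and replace the other occurrence of $x$ by $u$; substitution in the interface is included. An interaction system is strongly upward confluent if and only if for all configurations $s_1,s_2,s$ with $s_1\rightarrow s$ and $s_2\rightarrow s$ there exists a configuration $s'$ with $s'\rightarrow s_1$ and $s'\rightarrow s_2$ (single reduction steps). -}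

module Defs where

open import Level using (Level; _⊔_; suc)
open import Data.Nat using (ℕ; _≤_)
open import Data.Nat.Properties using (_≟_)
open import Data.List using (List; []; _∷_; [_]; _++_; map; concatMap; filter; length)
open import Data.List.Membership.Propositional using (_∈_; _∉_)
open import Data.List.Relation.Binary.Disjoint.Propositional using (Disjoint)
open import Data.List.Relation.Binary.Permutation.Homogeneous using (Permutation)
open import Data.List.Relation.Unary.Unique.Propositional using (Unique)
open import Data.Product using (_×_; _,_; ∃-syntax)
open import Data.Sum using (_⊎_)
open import Data.Vec as Vec using (Vec; []; _∷_; toList; zipWith)
open import Function using (_∘_)
open import Function.Definitions using (Injective)
open import Relation.Binary.Construct.Closure.Equivalence using (EqClosure)
open import Relation.Binary.PropositionalEquality using (_≡_; _≢_)
open import Relation.Nullary using (¬_; yes; no)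

private
  variable
    a ℓ : Level

record Signature a : Set (suc a) where
  field
    Agent : Set a
    ar    : Agent → ℕ

Name : Set
Name = ℕ

occurrences : Name → List Name → ℕ
occurrences x xs = length (filter (x ≟_) xs)

module _ (S : Signature a) where
  open Signature S

  data Term : Set a where
    name  : Name → Term
    agent : (α : Agent) → Vec Term (ar α) → Term

  -- Equations are unordered: they are compared by _≈ᵉ_ below, never by _≡_.
  infix 6 _≐_
  data Equation : Set a where
    _≐_ : Term → Term → Equation

  -- Likewise the list of equations stands for a multiset, see _≈_ below.
  infix 4 ⟨_∣_⟩
  data RawConfiguration : Set a where
    ⟨_∣_⟩ : List Term → List Equation → RawConfiguration

  -- left[lefts] ⋈ right[rights], not yet required to be linear.
  record RawRule : Set a where
    constructor _[_]⋈_[_]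
    field
      left   : Agent
      lefts  : Vec Term (ar left)
      right  : Agent
      rights : Vec Term (ar right)

module _ {S : Signature a} where
  open Signature S

  mutual
    names : Term S → List Name
    names (name x)     = [ x ]
    names (agent _ ts) = namesᵛ ts

    namesᵛ : ∀ {n} → Vec (Term S) n → List Name
    namesᵛ []       = []
    namesᵛ (t ∷ ts) = names t ++ namesᵛ ts

  namesᵉ : Equation S → List Name
  namesᵉ (t ≐ u) = names t ++ names u

  namesᵐ : List (Equation S) → List Name
  namesᵐ = concatMap namesᵉ

  namesᶜ : RawConfiguration S → List Name
  namesᶜ ⟨ f ∣ Δ ⟩ = concatMap names f ++ namesᵐ Δ

  namesʳ : RawRule S → List Name
  namesʳ r = namesᵛ lefts ++ namesᵛ rights
    where open RawRule r

  Substitution : Set a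
  Substitution = Name → Term S

  infix 30 _↦_
  _↦_ : Name → Term S → Substitution
  (x ↦ u) y with x ≟ y
  ... | yes _ = u
  ... | no  _ = name y

  mutual
    sub : Substitution → Term S → Term S
    sub σ (name x)      = σ x
    sub σ (agent α ts)  = agent α (subᵛ σ ts)

    subᵛ : ∀ {n} → Substitution → Vec (Term S) n → Vec (Term S) n
    subᵛ σ []       = []
    subᵛ σ (t ∷ ts) = sub σ t ∷ subᵛ σ ts

  subᵉ : Substitution → Equation S → Equation S
  subᵉ σ (t ≐ u) = sub σ t ≐ sub σ u

  subᶜ : Substitution → RawConfiguration S → RawConfiguration S
  subᶜ σ ⟨ f ∣ Δ ⟩ = ⟨ map (sub σ) f ∣ map (subᵉ σ) Δ ⟩

  data _≈ᵉ_ : Equation S → Equation S → Set a where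
    same : ∀ {t u} → (t ≐ u) ≈ᵉ (t ≐ u)
    flip : ∀ {t u} → (t ≐ u) ≈ᵉ (u ≐ t)

  -- Equality of multisets of unordered equations.
  infix 4 _≈ᵐ_
  _≈ᵐ_ : List (Equation S) → List (Equation S) → Set a
  _≈ᵐ_ = Permutation _≈ᵉ_

  -- Only bound names, i.e. those with two occurrences, may be renamed.
  infix 4 _≈¹_
  data _≈¹_ : RawConfiguration S → RawConfiguration S → Set a where
    multiset : ∀ {f Δ Δ′} → Δ ≈ᵐ Δ′ → ⟨ f ∣ Δ ⟩ ≈¹ ⟨ f ∣ Δ′ ⟩
    α-rename : ∀ {c x y} → occurrences x (namesᶜ c) ≡ 2 → y ∉ namesᶜ c →
               c ≈¹ subᶜ (x ↦ name y) c

  infix 4 _≈_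
  _≈_ : RawConfiguration S → RawConfiguration S → Set a
  _≈_ = EqClosure _≈¹_

  renameʳ : (Name → Name) → RawRule S → RawRule S
  renameʳ ρ (α [ vs ]⋈ β [ ws ]) = α [ subᵛ (name ∘ ρ) vs ]⋈ β [ subᵛ (name ∘ ρ) ws ]

  flipʳ : RawRule S → RawRule S
  flipʳ (α [ vs ]⋈ β [ ws ]) = β [ ws ]⋈ α [ vs ]

  SameRule : RawRule S → RawRule S → Set a
  SameRule r r′ = ∃[ ρ ] Injective _≡_ _≡_ ρ × (r′ ≡ renameʳ ρ r ⊎ r′ ≡ renameʳ ρ (flipʳ r))

  SamePair : RawRule S → RawRule S → Set a
  SamePair r r′ = (left r ≡ left r′ × right r ≡ right r′) ⊎ (left r ≡ right r′ × right r ≡ left r′)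
    where open RawRule

  LinearRule : RawRule S → Set
  LinearRule r = ∀ {x} → x ∈ namesʳ r → occurrences x (namesʳ r) ≡ 2

  -- The multiset left(ts) ÷ right(us) for the given representative of the rule;
  -- making its names fresh is left to the caller.
  residual : (r : RawRule S) → Vec (Term S) (ar (RawRule.left r)) →
             Vec (Term S) (ar (RawRule.right r)) → List (Equation S)
  residual r ts us = toList (zipWith _≐_ ts lefts) ++ toList (zipWith _≐_ us rights)
    where open RawRule r

  Disconnected : RawRule S → Set a
  Disconnected r =
    ∃[ xs ] ∃[ ys ] ∃[ Γ ] ∃[ Δ ]
      Unique (toList xs ++ toList ys) ×
      Disjoint (toList xs ++ toList ys) (namesʳ r) ×
      residual r (Vec.map name xs) (Vec.map name ys) ≈ᵐ Γ ++ Δ ×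
      Γ ≢ [] × Δ ≢ [] ×
      Disjoint (namesᵐ Γ) (namesᵐ Δ)

  Connected : RawRule S → Set a
  Connected r = ¬ Disconnected r

record Configuration (S : Signature a) : Set a where
  field
    raw    : RawConfiguration S
    linear : ∀ x → occurrences x (namesᶜ raw) ≤ 2

-- IsRule picks representatives of the rules; by unique, at most one rule
-- (up to SameRule) is represented for each unordered pair of agent types.
record InteractionSystem a ℓ : Set (suc (a ⊔ ℓ)) where
  field
    signature : Signature a
    IsRule    : RawRule signature → Set ℓ
    linear    : ∀ {r} → IsRule r → LinearRule r
    unique    : ∀ {r r′} → IsRule r → IsRule r′ → SamePair r r′ → SameRule r r′

module _ (I : InteractionSystem a ℓ) where
  open InteractionSystem I

  -- A step between chosen representatives.
  data RawStep : RawConfiguration signature → RawConfiguration signature → Set (a ⊔ ℓ) where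
    interaction : ∀ {r f Δ ts us} (ρ : Name → Name) → IsRule r → Injective _≡_ _≡_ ρ →
      let open RawRule r
          c = ⟨ f ∣ (agent left ts ≐ agent right us) ∷ Δ ⟩
      in (∀ {x} → x ∈ namesʳ r → ρ x ∉ namesᶜ c) →
         RawStep c ⟨ f ∣ residual (renameʳ ρ r) ts us ++ Δ ⟩
    indirection : ∀ {f Δ x u} → x ∉ names u → x ∈ namesᶜ ⟨ f ∣ Δ ⟩ →
      RawStep ⟨ f ∣ (name x ≐ u) ∷ Δ ⟩ (subᶜ (x ↦ u) ⟨ f ∣ Δ ⟩)

  Step : Configuration signature → Configuration signature → Set (a ⊔ ℓ)
  Step s s′ = ∃[ c ] ∃[ c′ ] raw s ≈ c × RawStep c c′ × c′ ≈ raw s′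
    where open Configuration

  StronglyUpwardConfluent : Set (a ⊔ ℓ)
  StronglyUpwardConfluent =
    ∀ s₁ s₂ s → Step s₁ s → Step s₂ s → ∃[ s′ ] Step s′ s₁ × Step s′ s₂

{-
Suppose the residual R of a disconnected rule α[v] ⋈ β[w] splits as Γ, Δ, and let R₁, R₂ be copies of R
on disjoint sets of names. Then Γ₁, Δ₁, Γ₂, Δ₂ arises in one interaction both from
s₁ = ⟨ ∣ α(x₁) = β(y₁), R₂ ⟩ and from the s₂ whose active pair takes the ports of Γ from the first copy
and those of Δ from the second. The ports occur once, so α-conversion does not touch them. Let p be a
port of Γ₁, and q, z the same port of Δ₁ and Δ₂: in s₁ an equation joins p to q and z lies in another
connected component, in s₂ an equation joins p to z and q lies in another component.

Separation into components, witnessed by a 2-colouring of the names that is constant on every equation,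
is preserved by every step and reflected by indirections. So if a common predecessor s′ of s₁ and s₂
led to s₁ by an indirection, p and z would be separated in s′ and hence in s₂; likewise for s₂.
If both steps are interactions, p, q and z lie in one equation of s′, which both steps consume. From the
step to s₁, some argument of that active pair contains p and q, from the step to s₂ none does.
-}
module Submission where

open import Algebra using (CommutativeMonoid)
import Algebra.Properties.CommutativeSemigroup as CommutativeSemigroupProperties
open import Data.Bool using (Bool; true; false; not; _xor_)
open import Data.Empty using (⊥)
open import Data.List using (List; []; _∷_; [_]; _++_; map; concatMap; filter; length)
open import Data.List.Membership.Propositional using (_∈_; _∉_; lose; find)
open import Data.List.Membership.Propositional.Properties
  using (∈-++⁺ˡ; ∈-++⁺ʳ; ∈-++⁻; ∈-map⁺; ∈-map⁻; ∈-concatMap⁺; ∈-concatMap⁻)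
open import Data.List.Properties
  using (filter-accept; filter-reject; filter-++; length-++; concatMap-++; ++-identityʳ;
         map-++; concatMap-pure; concatMap-map)
open import Data.List.Relation.Binary.Disjoint.Propositional using (Disjoint)
open import Data.List.Relation.Binary.Permutation.Homogeneous as Perm using ()
import Data.List.Relation.Binary.Permutation.Setoid.Properties as PermProperties
open import Data.List.Relation.Binary.Pointwise using ([]; _∷_)
open import Data.List.Relation.Unary.All as All using (All; []; _∷_)
import Data.List.Relation.Unary.All.Properties as All
open import Data.List.Relation.Unary.AllPairs using ([]; _∷_)
open import Data.List.Relation.Unary.Any as Any using (Any; here; there)
import Data.List.Relation.Unary.Any.Properties as Any
open import Data.List.Relation.Unary.Unique.Propositional using (Unique)
open import Data.Nat using (ℕ; zero; suc; _+_; _*_; _≤_; z≤n; s≤s)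
open import Data.Nat.Properties as ℕ using (_≟_)
open import Data.Product using (_×_; _,_; proj₁; proj₂; ∃-syntax)
open import Data.Sum using (_⊎_; inj₁; inj₂)
open import Data.Vec as Vec using (Vec; []; _∷_; toList; zipWith)
open import Function using (_∘_; id)
open import Function.Definitions using (Injective)
open import Level using (Level; _⊔_)
open import Relation.Binary using (Setoid; _Respects_)
open import Relation.Binary.Construct.Closure.Equivalence as EqClosure using ()
open import Relation.Binary.Construct.Closure.ReflexiveTransitive using (ε; _◅_)
open import Relation.Binary.Construct.Closure.Symmetric using (fwd; bwd)
open import Relation.Binary.PropositionalEquality
  using (_≡_; _≢_; refl; sym; trans; cong; cong₂; subst; subst₂)
open import Relation.Nullary using (¬_; does; yes; no; contradiction)

open import Defs

open CommutativeSemigroupProperties ℕ.+-commutativeSemigroup using (interchange; x∙yz≈y∙xz)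
open import Data.List.Membership.DecPropositional _≟_ using (_∈?_)

private
  variable
    a ℓ : Level
    x y z p q : Name
    L M : List Name
    ρ : Name → Name

-- Counting occurrences in lists of names.

occ-here : ∀ x L → occurrences x (x ∷ L) ≡ suc (occurrences x L)
occ-here x L = cong length (filter-accept (x ≟_) refl)

occ-there : ∀ L → x ≢ y → occurrences x (y ∷ L) ≡ occurrences x L
occ-there {x = x} L x≢y = cong length (filter-reject (x ≟_) x≢y)

occ-++ : ∀ x L M → occurrences x (L ++ M) ≡ occurrences x L + occurrences x M
occ-++ x L M = trans (cong length (filter-++ (x ≟_) L M)) (length-++ (filter (x ≟_) L))

occ-∉ : ∀ L → x ∉ L → occurrences x L ≡ 0
occ-∉ []      x∉L = refl
occ-∉ (y ∷ L) x∉L = trans (occ-there L (x∉L ∘ here)) (occ-∉ L (x∉L ∘ there))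

occ-∈ : x ∈ L → 1 ≤ occurrences x L
occ-∈ {x = x} {L = _ ∷ L} (here refl) = subst (1 ≤_) (sym (occ-here x L)) (s≤s z≤n)
occ-∈ {x = x} {L = y ∷ L} (there x∈L) with x ≟ y
... | yes refl = subst (1 ≤_) (sym (occ-here x L)) (s≤s z≤n)
... | no  x≢y  = subst (1 ≤_) (sym (occ-there L x≢y)) (occ-∈ x∈L)

occ≡0⇒∉ : occurrences x L ≡ 0 → x ∉ L
occ≡0⇒∉ eq x∈L with subst (1 ≤_) eq (occ-∈ x∈L)
... | ()

occ≡suc⇒∈ : ∀ {n} → occurrences x L ≡ suc n → x ∈ L
occ≡suc⇒∈ {x = x} {L = L} eq with x ∈? L
... | yes x∈L = x∈L
... | no  x∉L with trans (sym eq) (occ-∉ L x∉L)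
...   | ()

occ-Unique : Unique L → x ∈ L → occurrences x L ≡ 1
occ-Unique {L = x ∷ L} (x≢ ∷ _) (here refl) =
  trans (occ-here x L) (cong suc (occ-∉ L λ x∈L → All.lookup x≢ x∈L refl))
occ-Unique {L = y ∷ L} (y≢ ∷ u) (there x∈L) =
  trans (occ-there L λ { refl → All.lookup y≢ x∈L refl }) (occ-Unique u x∈L)

occ-map-injective : Injective _≡_ _≡_ ρ → ∀ x L → occurrences (ρ x) (map ρ L) ≡ occurrences x L
occ-map-injective inj x [] = refl
occ-map-injective {ρ = ρ} inj x (y ∷ L) with x ≟ y
... | yes refl = trans (occ-here (ρ x) (map ρ L))
                   (trans (cong suc (occ-map-injective inj x L)) (sym (occ-here x L)))
... | no  x≢y  = trans (occ-there (map ρ L) (x≢y ∘ inj))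
                   (trans (occ-map-injective inj x L) (sym (occ-there L x≢y)))

module _ {S : Signature a} where
  open Signature S

  private
    variable
      t u : Term S
      e : Equation S
      f : List (Term S)
      Γ Δ Δ′ Θ : List (Equation S)
      c c′ : RawConfiguration S
      σ τ : Substitution {S = S}

  -- Names and occurrence counts under substitution.

  ↦-same : ∀ x (u : Term S) → (x ↦ u) x ≡ u
  ↦-same x u with x ≟ x
  ... | yes _  = refl
  ... | no x≢x = contradiction refl x≢x

  ↦-other : ∀ (u : Term S) → x ≢ z → (x ↦ u) z ≡ name z
  ↦-other {x = x} {z = z} u x≢z with x ≟ z
  ... | yes x≡z = contradiction x≡z x≢z
  ... | no  _   = refl

  mutual
    names-sub : ∀ (σ : Substitution {S = S}) t → names (sub σ t) ≡ concatMap (names ∘ σ) (names t)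
    names-sub σ (name x)     = sym (++-identityʳ _)
    names-sub σ (agent _ ts) = namesᵛ-sub σ ts

    namesᵛ-sub : ∀ {n} (σ : Substitution {S = S}) (ts : Vec (Term S) n) →
                 namesᵛ (subᵛ σ ts) ≡ concatMap (names ∘ σ) (namesᵛ ts)
    namesᵛ-sub σ []       = refl
    namesᵛ-sub σ (t ∷ ts) = trans (cong₂ _++_ (names-sub σ t) (namesᵛ-sub σ ts))
                                  (sym (concatMap-++ _ (names t) (namesᵛ ts)))

  namesᵉ-sub : ∀ (σ : Substitution {S = S}) e → namesᵉ (subᵉ σ e) ≡ concatMap (names ∘ σ) (namesᵉ e)
  namesᵉ-sub σ (t ≐ u) = trans (cong₂ _++_ (names-sub σ t) (names-sub σ u))
                               (sym (concatMap-++ _ (names t) (names u)))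

  -- Generic in the element type so as to serve both the terms of the interface and the equations;
  -- `map-inverse` is generic for the same reason.
  concatMap-sub : ∀ {A : Set a} (ns : A → List Name) (s : A → A) (g : Name → List Name) →
                  (∀ e → ns (s e) ≡ concatMap g (ns e)) →
                  ∀ es → concatMap ns (map s es) ≡ concatMap g (concatMap ns es)
  concatMap-sub ns s g eq []       = refl
  concatMap-sub ns s g eq (e ∷ es) = trans (cong₂ _++_ (eq e) (concatMap-sub ns s g eq es))
                                           (sym (concatMap-++ g (ns e) (concatMap ns es)))

  namesᵐ-sub : ∀ (σ : Substitution {S = S}) Δ → namesᵐ (map (subᵉ σ) Δ) ≡ concatMap (names ∘ σ) (namesᵐ Δ)
  namesᵐ-sub σ = concatMap-sub namesᵉ (subᵉ σ) _ (namesᵉ-sub σ)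

  namesᶜ-sub : ∀ (σ : Substitution {S = S}) c → namesᶜ (subᶜ σ c) ≡ concatMap (names ∘ σ) (namesᶜ c)
  namesᶜ-sub σ ⟨ f ∣ Δ ⟩ =
    trans (cong₂ _++_ (concatMap-sub names (sub σ) _ (names-sub σ) f) (namesᵐ-sub σ Δ))
          (sym (concatMap-++ _ (concatMap names f) (namesᵐ Δ)))

  mutual
    sub-cong : ∀ t → (∀ {z} → z ∈ names t → σ z ≡ τ z) → sub σ t ≡ sub τ t
    sub-cong (name x)     eq = eq (here refl)
    sub-cong (agent α ts) eq = cong (agent α) (subᵛ-cong ts eq)

    subᵛ-cong : ∀ {n} (ts : Vec (Term S) n) → (∀ {z} → z ∈ namesᵛ ts → σ z ≡ τ z) → subᵛ σ ts ≡ subᵛ τ ts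
    subᵛ-cong []       eq = refl
    subᵛ-cong (t ∷ ts) eq = cong₂ _∷_ (sub-cong t (eq ∘ ∈-++⁺ˡ))
                                      (subᵛ-cong ts (eq ∘ ∈-++⁺ʳ (names t)))

  mutual
    sub-inverse : ∀ t → (∀ {z} → z ∈ names t → sub τ (σ z) ≡ name z) → sub τ (sub σ t) ≡ t
    sub-inverse (name x)     eq = eq (here refl)
    sub-inverse (agent α ts) eq = cong (agent α) (subᵛ-inverse ts eq)

    subᵛ-inverse : ∀ {n} (ts : Vec (Term S) n) → (∀ {z} → z ∈ namesᵛ ts → sub τ (σ z) ≡ name z) →
                   subᵛ τ (subᵛ σ ts) ≡ ts
    subᵛ-inverse []       eq = refl
    subᵛ-inverse (t ∷ ts) eq = cong₂ _∷_ (sub-inverse t (eq ∘ ∈-++⁺ˡ))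
                                         (subᵛ-inverse ts (eq ∘ ∈-++⁺ʳ (names t)))

  subᵉ-inverse : ∀ e → (∀ {z} → z ∈ namesᵉ e → sub τ (σ z) ≡ name z) → subᵉ τ (subᵉ σ e) ≡ e
  subᵉ-inverse (t ≐ u) eq = cong₂ _≐_ (sub-inverse t (eq ∘ ∈-++⁺ˡ)) (sub-inverse u (eq ∘ ∈-++⁺ʳ (names t)))

  map-inverse : ∀ {A : Set a} (ns : A → List Name) (s s′ : A → A) {P : Name → Set a} →
                (∀ e → (∀ {z} → z ∈ ns e → P z) → s (s′ e) ≡ e) →
                ∀ es → (∀ {z} → z ∈ concatMap ns es → P z) → map s (map s′ es) ≡ es
  map-inverse ns s s′ inv []       h = refl
  map-inverse ns s s′ inv (e ∷ es) h =
    cong₂ _∷_ (inv e (h ∘ ∈-++⁺ˡ)) (map-inverse ns s s′ inv es (h ∘ ∈-++⁺ʳ (ns e)))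

  subᶜ-inverse : ∀ c → (∀ {z} → z ∈ namesᶜ c → sub τ (σ z) ≡ name z) → subᶜ τ (subᶜ σ c) ≡ c
  subᶜ-inverse ⟨ f ∣ Δ ⟩ eq =
    cong₂ ⟨_∣_⟩ (map-inverse names _ _ sub-inverse f (eq ∘ ∈-++⁺ˡ))
                (map-inverse namesᵉ _ _ subᵉ-inverse Δ (eq ∘ ∈-++⁺ʳ (concatMap names f)))

  ∈-↦⁻ : ∀ L → z ∈ concatMap (names ∘ (x ↦ u)) L → (z ∈ L × z ≢ x) ⊎ (x ∈ L × z ∈ names u)
  ∈-↦⁻ {x = x} {u = u} L z∈ with find (∈-concatMap⁻ (names ∘ (x ↦ u)) z∈)
  ... | w , w∈L , z∈w with x ≟ w
  ...   | yes refl = inj₂ (w∈L , z∈w)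
  ...   | no  x≢w with z∈w
  ...     | here refl = inj₁ (w∈L , x≢w ∘ sym)

  ∈-↦⁺-other : z ∈ L → z ≢ x → z ∈ concatMap (names ∘ (x ↦ u)) L
  ∈-↦⁺-other {z = z} {u = u} z∈L z≢x = ∈-concatMap⁺ _
    (lose z∈L (subst (λ t → z ∈ names t) (sym (↦-other u (z≢x ∘ sym))) (here refl)))

  ∈-↦⁺-same : x ∈ L → z ∈ names u → z ∈ concatMap (names ∘ (x ↦ u)) L
  ∈-↦⁺-same {x = x} {z = z} {u = u} x∈L z∈u = ∈-concatMap⁺ _
    (lose x∈L (subst (λ t → z ∈ names t) (sym (↦-same x u)) z∈u))

  -- Each occurrence of `x` turns into a copy of `u`, which explains the product; an occurrence of
  -- `z` is left in place because `z` differs from `x`.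
  occ-↦ : ∀ L → z ≢ x → occurrences z (concatMap (names ∘ (x ↦ u)) L) ≡
                        occurrences z L + occurrences x L * occurrences z (names u)
  occ-↦ [] z≢x = refl
  occ-↦ {z = z} {x = x} {u = u} (y ∷ L) z≢x
    rewrite occ-++ z (names ((x ↦ u) y)) (concatMap (names ∘ (x ↦ u)) L) | occ-↦ {u = u} L z≢x
    = helper (x ≟ y)
    where
    oz = occurrences z (names u)
    helper : _ → occurrences z (names ((x ↦ u) y)) + (occurrences z L + occurrences x L * oz) ≡
             occurrences z (y ∷ L) + occurrences x (y ∷ L) * oz
    helper (yes refl) rewrite ↦-same x u | occ-here x L | occ-there L z≢x =
      x∙yz≈y∙xz oz (occurrences z L) _
    helper (no x≢y) rewrite ↦-other u x≢y | occ-there L x≢y =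
      trans (sym (ℕ.+-assoc (occurrences z [ y ]) (occurrences z L) _))
            (cong (_+ _) (sym (occ-++ z [ y ] L)))

  occ-↦-self : ∀ L → x ∉ names u → occurrences x (concatMap (names ∘ (x ↦ u)) L) ≡ 0
  occ-↦-self {x = x} {u = u} L x∉u = occ-∉ _ helper
    where
    helper : x ∉ concatMap (names ∘ (x ↦ u)) L
    helper x∈ with ∈-↦⁻ L x∈
    ... | inj₁ (_ , x≢x) = x≢x refl
    ... | inj₂ (_ , x∈u) = x∉u x∈u

  -- Occurrence counts in configurations and multisets of equations.

  equations : RawConfiguration S → List (Equation S)
  equations ⟨ _ ∣ Δ ⟩ = Δ

  interface : RawConfiguration S → List (Term S)
  interface ⟨ f ∣ _ ⟩ = f

  occ-∷ : ∀ z (f : List (Term S)) e Δ → occurrences z (namesᶜ ⟨ f ∣ e ∷ Δ ⟩) ≡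
                      occurrences z (namesᵉ e) + occurrences z (namesᶜ ⟨ f ∣ Δ ⟩)
  occ-∷ z f e Δ
    rewrite occ-++ z (concatMap names f) (namesᵉ e ++ namesᵐ Δ) | occ-++ z (namesᵉ e) (namesᵐ Δ)
          | occ-++ z (concatMap names f) (namesᵐ Δ)
    = x∙yz≈y∙xz (occurrences z (concatMap names f)) (occurrences z (namesᵉ e)) _

  occ-++ᵐ : ∀ z (f : List (Term S)) Γ Δ → occurrences z (namesᶜ ⟨ f ∣ Γ ++ Δ ⟩) ≡
                        occurrences z (namesᵐ Γ) + occurrences z (namesᶜ ⟨ f ∣ Δ ⟩)
  occ-++ᵐ z f Γ Δ
    rewrite concatMap-++ namesᵉ Γ Δ
          | occ-++ z (concatMap names f) (namesᵐ Γ ++ namesᵐ Δ) | occ-++ z (namesᵐ Γ) (namesᵐ Δ)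
          | occ-++ z (concatMap names f) (namesᵐ Δ)
    = x∙yz≈y∙xz (occurrences z (concatMap names f)) (occurrences z (namesᵐ Γ)) _

  ≈ᵉ-sym : ∀ {e e′ : Equation S} → e ≈ᵉ e′ → e′ ≈ᵉ e
  ≈ᵉ-sym same = same
  ≈ᵉ-sym flip = flip

  ≈ᵉ-trans : ∀ {e e′ e″ : Equation S} → e ≈ᵉ e′ → e′ ≈ᵉ e″ → e ≈ᵉ e″
  ≈ᵉ-trans same e≈ = e≈
  ≈ᵉ-trans flip same = flip
  ≈ᵉ-trans flip flip = same

  ≈ᵉ-refl : e ≈ᵉ e
  ≈ᵉ-refl {e = _ ≐ _} = same

  ≈ᵉ-setoid : Setoid a a
  ≈ᵉ-setoid = record
    { Carrier = Equation S
    ; _≈_ = _≈ᵉ_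
    ; isEquivalence = record { refl = ≈ᵉ-refl ; sym = ≈ᵉ-sym ; trans = ≈ᵉ-trans }
    }

  occ-≈ᵉ : ∀ z {e e′ : Equation S} → e ≈ᵉ e′ → occurrences z (namesᵉ e) ≡ occurrences z (namesᵉ e′)
  occ-≈ᵉ z same = refl
  occ-≈ᵉ z (flip {t} {u}) = trans (occ-++ z (names t) (names u))
    (trans (ℕ.+-comm (occurrences z (names t)) _) (sym (occ-++ z (names u) (names t))))

  occ-∷-cong : ∀ z (e e′ : Equation S) Δ Δ′ → occurrences z (namesᵉ e) ≡ occurrences z (namesᵉ e′) →
               occurrences z (namesᵐ Δ) ≡ occurrences z (namesᵐ Δ′) →
               occurrences z (namesᵐ (e ∷ Δ)) ≡ occurrences z (namesᵐ (e′ ∷ Δ′))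
  occ-∷-cong z e e′ Δ Δ′ eq eqs
    rewrite occ-++ z (namesᵉ e) (namesᵐ Δ) | occ-++ z (namesᵉ e′) (namesᵐ Δ′) = cong₂ _+_ eq eqs

  occ-swap : ∀ z (e e′ : Equation S) Δ →
             occurrences z (namesᵐ (e ∷ e′ ∷ Δ)) ≡ occurrences z (namesᵐ (e′ ∷ e ∷ Δ))
  occ-swap z e e′ Δ
    rewrite occ-++ z (namesᵉ e) (namesᵉ e′ ++ namesᵐ Δ) | occ-++ z (namesᵉ e′) (namesᵐ Δ)
          | occ-++ z (namesᵉ e′) (namesᵉ e ++ namesᵐ Δ) | occ-++ z (namesᵉ e) (namesᵐ Δ)
    = x∙yz≈y∙xz (occurrences z (namesᵉ e)) (occurrences z (namesᵉ e′)) _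

  occ-≈ᵐ : ∀ z → Δ ≈ᵐ Δ′ → occurrences z (namesᵐ Δ) ≡ occurrences z (namesᵐ Δ′)
  occ-≈ᵐ z (Perm.refl []) = refl
  occ-≈ᵐ z (Perm.refl (_∷_ {x = e} {e′} {Γ} {Γ′} e≈ Γ≈)) =
    occ-∷-cong z e e′ Γ Γ′ (occ-≈ᵉ z e≈) (occ-≈ᵐ z (Perm.refl Γ≈))
  occ-≈ᵐ z (Perm.prep {Γ} {Γ′} {e} {e′} e≈ Γ≈) = occ-∷-cong z e e′ Γ Γ′ (occ-≈ᵉ z e≈) (occ-≈ᵐ z Γ≈)
  occ-≈ᵐ z (Perm.swap {Γ} {Γ′} {e₁} {e₂} {e₁′} {e₂′} e₁≈ e₂≈ Γ≈) =
    trans (occ-swap z e₁ e₂ Γ)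
      (occ-∷-cong z e₂ e₂′ (e₁ ∷ Γ) (e₁′ ∷ Γ′) (occ-≈ᵉ z e₂≈)
        (occ-∷-cong z e₁ e₁′ Γ Γ′ (occ-≈ᵉ z e₁≈) (occ-≈ᵐ z Γ≈)))
  occ-≈ᵐ z (Perm.trans p q) = trans (occ-≈ᵐ z p) (occ-≈ᵐ z q)

  -- α-conversion, linearity and free names.

  occ-rename : ∀ L → y ∉ L → occurrences y (concatMap (names ∘ (x ↦ name {S = S} y)) L) ≡ occurrences x L
  occ-rename [] y∉L = refl
  occ-rename {y = y} {x = x} (z ∷ L) y∉L
    rewrite occ-++ y (names ((x ↦ name {S = S} y) z)) (concatMap (names ∘ (x ↦ name {S = S} y)) L)
          | occ-rename {x = x} L (y∉L ∘ there)
    = helper (x ≟ z)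
    where
    helper : _ → occurrences y (names ((x ↦ name {S = S} y) z)) + occurrences x L ≡ occurrences x (z ∷ L)
    helper (yes refl) rewrite ↦-same x (name {S = S} y) | occ-here x L | occ-here y [] = refl
    helper (no x≢z) rewrite ↦-other (name {S = S} y) x≢z | occ-there L x≢z
                          | occ-there {x = y} [] (y∉L ∘ here) = refl

  -- Renaming `x` to `y` is undone by renaming `y` to `x`. This is again a legal α-conversion: `y`
  -- has taken over both occurrences of `x`, and `x` has disappeared because it differs from `y`.
  ≈¹-sym : c ≈¹ c′ → c′ ≈¹ c
  ≈¹-sym (multiset Δ≈Δ′) = multiset (Perm.sym ≈ᵉ-sym Δ≈Δ′)
  ≈¹-sym (α-rename {c = c} {x = x} {y = y} occ≡2 y∉c) =
    subst (subᶜ (x ↦ name y) c ≈¹_) (subᶜ-inverse c inverse)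
      (α-rename (trans (cong (occurrences y) (namesᶜ-sub _ c)) (trans (occ-rename (namesᶜ c) y∉c) occ≡2))
                (x∉ ∘ subst (x ∈_) (namesᶜ-sub _ c)))
    where
    x≢y : x ≢ y
    x≢y refl = y∉c (occ≡suc⇒∈ occ≡2)
    x∉ : x ∉ concatMap (names ∘ (x ↦ name {S = S} y)) (namesᶜ c)
    x∉ x∈ with ∈-↦⁻ (namesᶜ c) x∈
    ... | inj₁ (_ , x≢x)       = x≢x refl
    ... | inj₂ (_ , here x≡y) = x≢y x≡y
    inverse : z ∈ namesᶜ c → sub (y ↦ name x) ((x ↦ name {S = S} y) z) ≡ name z
    inverse {z = z} z∈c with x ≟ z
    ... | yes refl = ↦-same y (name x)
    ... | no  _    = ↦-other (name x) λ { refl → y∉c z∈c }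

  Free : Name → RawConfiguration S → Set
  Free p c = occurrences p (namesᶜ c) ≡ 1

  Linear : RawConfiguration S → Set
  Linear c = ∀ z → occurrences z (namesᶜ c) ≤ 2

  occ-multiset : ∀ z f → Δ ≈ᵐ Δ′ → occurrences z (namesᶜ ⟨ f ∣ Δ ⟩) ≡ occurrences z (namesᶜ ⟨ f ∣ Δ′ ⟩)
  occ-multiset z f Δ≈ = trans (occ-++ z (concatMap names f) _)
    (trans (cong (occurrences z (concatMap names f) +_) (occ-≈ᵐ z Δ≈))
           (sym (occ-++ z (concatMap names f) _)))

  occ-rename-other : ∀ c → z ≢ x → z ≢ y →
                     occurrences z (namesᶜ (subᶜ (x ↦ name y) c)) ≡ occurrences z (namesᶜ c)
  occ-rename-other {z = z} {x = x} {y = y} c z≢x z≢y =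
    trans (cong (occurrences z) (namesᶜ-sub (x ↦ name y) c)) (trans (occ-↦ (namesᶜ c) z≢x) y-absent)
    where
    y-absent : occurrences z (namesᶜ c) + occurrences x (namesᶜ c) * occurrences z [ y ] ≡ occurrences z (namesᶜ c)
    y-absent rewrite occ-there {x = z} [] z≢y | ℕ.*-zeroʳ (occurrences x (namesᶜ c)) = ℕ.+-identityʳ _

  -- A renaming moves the two occurrences of `x` to `y`, which had none before; every other count
  -- stays the same.
  Linear-≈¹ : c ≈¹ c′ → Linear c → Linear c′
  Linear-≈¹ (multiset {f = f} Δ≈Δ′) lin z = subst (_≤ 2) (occ-multiset z f Δ≈Δ′) (lin z)
  Linear-≈¹ (α-rename {c = c} {x = x} {y = y} occ≡2 y∉c) lin z with z ≟ x | z ≟ y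
  ... | _        | yes refl = ℕ.≤-reflexive
    (trans (cong (occurrences z) (namesᶜ-sub _ c)) (trans (occ-rename (namesᶜ c) y∉c) occ≡2))
  ... | yes refl | no z≢y = subst (_≤ 2)
    (sym (trans (cong (occurrences z) (namesᶜ-sub _ c)) (occ-↦-self (namesᶜ c) λ { (here z≡y) → z≢y z≡y }))) z≤n
  ... | no z≢x   | no z≢y = subst (_≤ 2) (sym (occ-rename-other c z≢x z≢y)) (lin z)

  -- As `≈¹` is symmetric, a backward link of the chain is also a forward one, so an invariant has
  -- to be checked in one direction only.
  ≈-induction : ∀ {ℓ} (X : RawConfiguration S → Set ℓ) → (∀ {c c′} → c ≈¹ c′ → X c → X c′) →
                c ≈ c′ → X c → X c′
  ≈-induction X step ε             Xc = Xc
  ≈-induction X step (fwd s ◅ rest) Xc = ≈-induction X step rest (step s Xc)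
  ≈-induction X step (bwd s ◅ rest) Xc = ≈-induction X step rest (step (≈¹-sym s) Xc)

  ≈-sym : c ≈ c′ → c′ ≈ c
  ≈-sym = EqClosure.symmetric _

  Linear-≈ : c ≈ c′ → Linear c → Linear c′
  Linear-≈ = ≈-induction Linear Linear-≈¹

  Free⇒≢ : ∀ {c} → Free p c → occurrences x (namesᶜ c) ≡ 2 → p ≢ x
  Free⇒≢ free occ≡2 refl with trans (sym free) occ≡2
  ... | ()

  Free⇒≢′ : ∀ {c} → Free p c → y ∉ namesᶜ c → p ≢ y
  Free⇒≢′ free y∉c refl = y∉c (occ≡suc⇒∈ free)

  Free-≈¹ : c ≈¹ c′ → Free p c → Free p c′
  Free-≈¹ {p = p} (multiset {f = f} Δ≈Δ′) free = trans (sym (occ-multiset p f Δ≈Δ′)) free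
  Free-≈¹ (α-rename {c = c} occ≡2 y∉c) free =
    trans (occ-rename-other c (Free⇒≢ {c = c} free occ≡2) (Free⇒≢′ {c = c} free y∉c)) free

  Free-≈ : c ≈ c′ → Free p c → Free p c′
  Free-≈ = ≈-induction (Free _) Free-≈¹

  -- Free names are never renamed, so they can be used to address parts of a configuration up to _≈_.
  ≈-transport : ∀ {ℓ} (X : RawConfiguration S → Set ℓ) →
    (∀ {f Δ Δ′} → Δ ≈ᵐ Δ′ → X ⟨ f ∣ Δ ⟩ → X ⟨ f ∣ Δ′ ⟩) →
    (∀ {c x y} → p ≢ x → q ≢ x → p ≢ y → q ≢ y → y ∉ namesᶜ c → X c → X (subᶜ (x ↦ name y) c)) →
    c ≈ c′ → Free p c → Free q c → X c → X c′
  ≈-transport {p = p} {q = q} X permute rename c≈c′ free-p free-q Xc =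
    proj₂ (proj₂ (≈-induction (λ c → Free p c × Free q c × X c) step c≈c′ (free-p , free-q , Xc)))
    where
    step : ∀ {c c′} → c ≈¹ c′ → Free p c × Free q c × X c → Free p c′ × Free q c′ × X c′
    step s (free-p , free-q , Xc) = Free-≈¹ s free-p , Free-≈¹ s free-q , X′ s
      where
      X′ : ∀ {c′} → _ ≈¹ c′ → X c′
      X′ (multiset Δ≈Δ′)               = permute Δ≈Δ′ Xc
      X′ (α-rename {c = c} occ≡2 y∉c) =
        rename (Free⇒≢ {c = c} free-p occ≡2) (Free⇒≢ {c = c} free-q occ≡2)
               (Free⇒≢′ {c = c} free-p y∉c) (Free⇒≢′ {c = c} free-q y∉c) y∉c Xc

  -- Names sharing an equation, names sharing an argument.

  Cooccur : Name → Name → RawConfiguration S → Set a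
  Cooccur p q c = Any (λ e → p ∈ namesᵉ e × q ∈ namesᵉ e) (equations c)

  arguments : Term S → List (Term S)
  arguments (name _)     = []
  arguments (agent _ ts) = toList ts

  argumentsᵉ : Equation S → List (Term S)
  argumentsᵉ (t ≐ u) = arguments t ++ arguments u

  -- Finer than `Cooccur`: an interaction puts each argument of the active pair into an equation of
  -- its own, so outer names that share an equation of the residual are those that shared an
  -- argument.
  Coargument : Name → Name → RawConfiguration S → Set a
  Coargument p q c = Any (λ e → Any (λ t → p ∈ names t × q ∈ names t) (argumentsᵉ e)) (equations c)

  ∈-rename⁺ : ∀ t → z ∈ names t → z ≢ x → z ∈ names (sub (x ↦ u) t)
  ∈-rename⁺ {z = z} t z∈t z≢x = subst (z ∈_) (sym (names-sub _ t)) (∈-↦⁺-other z∈t z≢x)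

  ∈-renameᵉ⁺ : ∀ e → z ∈ namesᵉ e → z ≢ x → z ∈ namesᵉ (subᵉ (x ↦ u) e)
  ∈-renameᵉ⁺ {z = z} e z∈e z≢x = subst (z ∈_) (sym (namesᵉ-sub _ e)) (∈-↦⁺-other z∈e z≢x)

  Cooccur-≈ : c ≈ c′ → Free p c → Free q c → Cooccur p q c → Cooccur p q c′
  Cooccur-≈ {p = p} {q = q} = ≈-transport (Cooccur p q) (PermProperties.Any-resp-↭ ≈ᵉ-setoid resp)
    λ { {c = ⟨ _ ∣ Δ ⟩} p≢x q≢x _ _ _ co →
        Any.map⁺ (Any.map (λ {e} (p∈ , q∈) → ∈-renameᵉ⁺ e p∈ p≢x , ∈-renameᵉ⁺ e q∈ q≢x) co) }
    where
    ∈-flip : ∀ {z t u} → z ∈ namesᵉ (t ≐ u) → z ∈ namesᵉ {S = S} (u ≐ t)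
    ∈-flip {t = t} {u} = Any.++-comm (names t) (names u)
    resp : (λ e → p ∈ namesᵉ e × q ∈ namesᵉ e) Respects _≈ᵉ_
    resp same co = co
    resp (flip {t} {u}) (p∈ , q∈) = ∈-flip {t = t} {u} p∈ , ∈-flip {t = t} {u} q∈

  arguments-sub : ∀ {ℓ} {P : Term S → Set ℓ} (σ : Substitution {S = S}) t →
                  Any (P ∘ sub σ) (arguments t) → Any P (arguments (sub σ t))
  arguments-sub σ (agent _ ts) = toList-sub ts
    where
    toList-sub : ∀ {ℓ n} {P : Term S → Set ℓ} (ts : Vec (Term S) n) →
                 Any (P ∘ sub σ) (toList ts) → Any P (toList (subᵛ σ ts))
    toList-sub (t ∷ ts) (here Pt)  = here Pt
    toList-sub (t ∷ ts) (there Pt) = there (toList-sub ts Pt)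

  argumentsᵉ-sub : ∀ {ℓ} {P : Term S → Set ℓ} (σ : Substitution {S = S}) e →
                   Any (P ∘ sub σ) (argumentsᵉ e) → Any P (argumentsᵉ (subᵉ σ e))
  argumentsᵉ-sub σ (t ≐ u) any with Any.++⁻ (arguments t) any
  ... | inj₁ any₁ = Any.++⁺ˡ (arguments-sub σ t any₁)
  ... | inj₂ any₂ = Any.++⁺ʳ (arguments (sub σ t)) (arguments-sub σ u any₂)

  Coargument-≈ : c ≈ c′ → Free p c → Free q c → Coargument p q c → Coargument p q c′
  Coargument-≈ {p = p} {q = q} = ≈-transport (Coargument p q) (PermProperties.Any-resp-↭ ≈ᵉ-setoid resp)
    λ { {c = ⟨ _ ∣ Δ ⟩} p≢x q≢x _ _ _ co →
        Any.map⁺ (Any.map (λ {e} → argumentsᵉ-sub _ e ∘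
          Any.map (λ {t} (p∈ , q∈) → ∈-rename⁺ t p∈ p≢x , ∈-rename⁺ t q∈ q≢x)) co) }
    where
    resp : (λ e → Any (λ t → p ∈ names t × q ∈ names t) (argumentsᵉ e)) Respects _≈ᵉ_
    resp same = id
    resp (flip {t} {u}) = Any.++-comm (arguments t) (arguments u)

  -- Two-colourings and separated names.

  Colouring : Set
  Colouring = Name → Bool

  Monochromatic : Colouring → Equation S → Set
  Monochromatic κ e = ∃[ k ] (∀ {z} → z ∈ namesᵉ e → κ z ≡ k)

  -- The empty interface forces every occurrence of a name into an equation, where the colouring
  -- constrains it. Otherwise an indirection could move a term with names of both colours from an
  -- equation into the interface, and separation would not be reflected.
  Separated : Name → Name → RawConfiguration S → Set a
  Separated p q c = ∃[ κ ] interface c ≡ [] × All (Monochromatic κ) (equations c) × κ p ≡ true × κ q ≡ false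

  Separated⇒¬Cooccur : Separated p q c → ¬ Cooccur p q c
  Separated⇒¬Cooccur (κ , _ , mono , κp , κq) co with find co
  ... | e , e∈ , p∈ , q∈ with All.lookup mono e∈
  ...   | k , κ≡k with trans (sym κp) (trans (κ≡k p∈) (trans (sym (κ≡k q∈)) κq))
  ...     | ()

  update : Colouring → Name → Bool → Colouring
  update κ x k z with z ≟ x
  ... | yes _ = k
  ... | no  _ = κ z

  update-same : ∀ κ x k → update κ x k x ≡ k
  update-same κ x k with x ≟ x
  ... | yes _  = refl
  ... | no x≢x = contradiction refl x≢x

  update-other : ∀ κ k → z ≢ x → update κ x k z ≡ κ z
  update-other {z = z} {x = x} κ k z≢x with z ≟ x
  ... | yes z≡x = contradiction z≡x z≢x
  ... | no  _   = refl

  ∈-namesᶜ : ∀ f → e ∈ Δ → z ∈ namesᵉ e → z ∈ namesᶜ ⟨ f ∣ Δ ⟩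
  ∈-namesᶜ f e∈ z∈ = ∈-++⁺ʳ (concatMap names f) (∈-concatMap⁺ namesᵉ (lose e∈ z∈))

  Separated-≈ : c ≈ c′ → Free p c → Free q c → Separated p q c → Separated p q c′
  Separated-≈ {p = p} {q = q} = ≈-transport (Separated p q)
    (λ { Δ≈ (κ , f≡[] , mono , κp , κq) →
         κ , f≡[] , PermProperties.All-resp-↭ ≈ᵉ-setoid (resp κ) Δ≈ mono , κp , κq })
    λ { {c = ⟨ [] ∣ Δ ⟩} {x} {y} _ _ p≢y q≢y y∉c (κ , refl , mono , κp , κq) →
        -- The new name inherits the colour of the one it replaces; since `p` and `q` differ from
        -- `y`, their colours survive.
        let κ′ = update κ y (κ x) in
        κ′ , refl ,
        All.map⁺ (All.tabulate λ {e} e∈ → recolour {e = e} κ (y∉c ∘ ∈-namesᶜ [] e∈) (All.lookup mono e∈)) ,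
        trans (update-other κ (κ x) p≢y) κp , trans (update-other κ (κ x) q≢y) κq }
    where
    resp : ∀ κ → Monochromatic κ Respects _≈ᵉ_
    resp κ same mono = mono
    resp κ (flip {t} {u}) (k , κ≡k) = k , κ≡k ∘ Any.++-comm (names u) (names t)
    recolour : ∀ κ → y ∉ namesᵉ e → Monochromatic κ e → Monochromatic (update κ y (κ x)) (subᵉ (x ↦ name y) e)
    recolour {y = y} {e = e} {x = x} κ y∉e (k , κ≡k) =
      k , λ z∈ → helper (∈-↦⁻ (namesᵉ e) (subst (_ ∈_) (namesᵉ-sub _ e) z∈))
      where
      helper : (z ∈ namesᵉ e × z ≢ x) ⊎ (x ∈ namesᵉ e × z ∈ [ y ]) → update κ y (κ x) z ≡ k
      helper (inj₁ (z∈e , _))       = trans (update-other κ (κ x) λ { refl → y∉e z∈e }) (κ≡k z∈e)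
      helper (inj₂ (x∈e , here refl)) = trans (update-same κ y (κ x)) (κ≡k x∈e)

  -- Names in the residual of an active pair.

  namesᵛ-toList : ∀ {n} (ts : Vec (Term S) n) → namesᵛ ts ≡ concatMap names (toList ts)
  namesᵛ-toList []       = refl
  namesᵛ-toList (t ∷ ts) = cong (names t ++_) (namesᵛ-toList ts)

  rename : (Name → Name) → Substitution {S = S}
  rename ρ = name ∘ ρ

  concatMap-rename : ∀ ρ L → concatMap (names ∘ rename ρ) L ≡ map ρ L
  concatMap-rename ρ L = trans (sym (concatMap-map [_] ρ L)) (concatMap-pure (map ρ L))

  namesᵉ-rename : ∀ ρ (e : Equation S) → namesᵉ (subᵉ (rename ρ) e) ≡ map ρ (namesᵉ e)
  namesᵉ-rename ρ e = trans (namesᵉ-sub (rename ρ) e) (concatMap-rename ρ (namesᵉ e))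

  namesᵐ-rename : ∀ ρ (Δ : List (Equation S)) → namesᵐ (map (subᵉ (rename ρ)) Δ) ≡ map ρ (namesᵐ Δ)
  namesᵐ-rename ρ Δ = trans (namesᵐ-sub (rename ρ) Δ) (concatMap-rename ρ (namesᵐ Δ))

  namesᵛ-rename : ∀ {n} ρ (ts : Vec (Term S) n) → namesᵛ (subᵛ (rename ρ) ts) ≡ map ρ (namesᵛ ts)
  namesᵛ-rename ρ ts = trans (namesᵛ-sub (rename ρ) ts) (concatMap-rename ρ (namesᵛ ts))

  namesʳ-rename : ∀ ρ (r : RawRule S) → namesʳ (renameʳ ρ r) ≡ map ρ (namesʳ r)
  namesʳ-rename ρ (α [ vs ]⋈ β [ ws ]) =
    trans (cong₂ _++_ (namesᵛ-rename ρ vs) (namesᵛ-rename ρ ws)) (sym (map-++ ρ (namesᵛ vs) (namesᵛ ws)))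

  Any-arguments⇒∈ : ∀ {n} (ts : Vec (Term S) n) → Any (λ t → p ∈ names t) (toList ts) → p ∈ namesᵛ ts
  Any-arguments⇒∈ ts p∈ = subst (_ ∈_) (sym (namesᵛ-toList ts)) (∈-concatMap⁺ names p∈)

  arguments⊆ : ∀ t → Any (λ t → p ∈ names t) (arguments t) → p ∈ names t
  arguments⊆ (agent _ ts) = Any-arguments⇒∈ ts

  argumentsᵉ⊆ : ∀ e → Any (λ t → p ∈ names t) (argumentsᵉ e) → p ∈ namesᵉ e
  argumentsᵉ⊆ (t ≐ u) p∈ with Any.++⁻ (arguments t) p∈
  ... | inj₁ p∈t = ∈-++⁺ˡ (arguments⊆ t p∈t)
  ... | inj₂ p∈u = ∈-++⁺ʳ (names t) (arguments⊆ u p∈u)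

  occ-zipWith : ∀ z {n} (ts vs : Vec (Term S) n) → occurrences z (namesᵐ (toList (zipWith _≐_ ts vs))) ≡
                occurrences z (namesᵛ ts) + occurrences z (namesᵛ vs)
  occ-zipWith z [] [] = refl
  occ-zipWith z (t ∷ ts) (v ∷ vs)
    rewrite occ-++ z (names t ++ names v) (namesᵐ (toList (zipWith _≐_ ts vs)))
          | occ-++ z (names t) (names v) | occ-++ z (names t) (namesᵛ ts) | occ-++ z (names v) (namesᵛ vs)
          | occ-zipWith z ts vs
    = interchange (occurrences z (names t)) (occurrences z (names v)) _ _

  activePair : (r : RawRule S) → Vec (Term S) (ar (RawRule.left r)) → Vec (Term S) (ar (RawRule.right r)) →
               Equation S
  activePair r ts us = agent (RawRule.left r) ts ≐ agent (RawRule.right r) us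

  occ-residual : ∀ z r ts us → occurrences z (namesᵐ (residual r ts us)) ≡
                 occurrences z (namesᵉ (activePair r ts us)) + occurrences z (namesʳ r)
  occ-residual z (α [ vs ]⋈ β [ ws ]) ts us
    rewrite concatMap-++ namesᵉ (toList (zipWith _≐_ ts vs)) (toList (zipWith _≐_ us ws))
          | occ-++ z (namesᵐ (toList (zipWith _≐_ ts vs))) (namesᵐ (toList (zipWith _≐_ us ws)))
          | occ-zipWith z ts vs | occ-zipWith z us ws
          | occ-++ z (namesᵛ ts) (namesᵛ us) | occ-++ z (namesᵛ vs) (namesᵛ ws)
    = interchange (occurrences z (namesᵛ ts)) (occurrences z (namesᵛ vs)) _ _

  -- Follows from the count in `occ-residual`: a name absent from both the pair and the rule has
  -- count zero.
  ∈-residual : ∀ r ts us → z ∈ namesᵐ (residual r ts us) → z ∈ namesᵉ (activePair r ts us) ⊎ z ∈ namesʳ r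
  ∈-residual {z = z} r ts us z∈ with z ∈? namesᵉ (activePair r ts us) | z ∈? namesʳ r
  ... | yes z∈e | _       = inj₁ z∈e
  ... | no  _   | yes z∈r = inj₂ z∈r
  ... | no  z∉e | no z∉r  = contradiction z∈
    (occ≡0⇒∉ (trans (occ-residual z r ts us) (cong₂ _+_ (occ-∉ _ z∉e) (occ-∉ _ z∉r))))

  zipWith⁻ : ∀ {n} (ts vs : Vec (Term S) n) → p ∉ namesᵛ vs → q ∉ namesᵛ vs →
    Any (λ e → p ∈ namesᵉ e × q ∈ namesᵉ e) (toList (zipWith _≐_ ts vs)) →
    Any (λ t → p ∈ names t × q ∈ names t) (toList ts)
  zipWith⁻ [] [] _ _ ()
  zipWith⁻ (t ∷ ts) (v ∷ vs) p∉ q∉ (here (p∈ , q∈)) with ∈-++⁻ (names t) p∈ | ∈-++⁻ (names t) q∈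
  ... | inj₁ p∈t | inj₁ q∈t = here (p∈t , q∈t)
  ... | inj₂ p∈v | _        = contradiction (∈-++⁺ˡ p∈v) p∉
  ... | inj₁ _   | inj₂ q∈v = contradiction (∈-++⁺ˡ q∈v) q∉
  zipWith⁻ (t ∷ ts) (v ∷ vs) p∉ q∉ (there co) =
    there (zipWith⁻ ts vs (p∉ ∘ ∈-++⁺ʳ (names v)) (q∉ ∘ ∈-++⁺ʳ (names v)) co)

  zipWith⁺ : ∀ {n} (ts vs : Vec (Term S) n) →
    Any (λ t → p ∈ names t × q ∈ names t) (toList ts) →
    Any (λ e → p ∈ namesᵉ e × q ∈ namesᵉ e) (toList (zipWith _≐_ ts vs))
  zipWith⁺ (t ∷ ts) (v ∷ vs) (here (p∈ , q∈)) = here (∈-++⁺ˡ p∈ , ∈-++⁺ˡ q∈)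
  zipWith⁺ (t ∷ ts) (v ∷ vs) (there co)       = there (zipWith⁺ ts vs co)

  -- Every equation of the residual joins an argument to a term of the rule. Names foreign to the
  -- rule can only stand on the argument side, so two of them in one equation lie in one argument.
  residual⁻ : ∀ r ts us → p ∉ namesʳ r → q ∉ namesʳ r →
    Any (λ e → p ∈ namesᵉ e × q ∈ namesᵉ e) (residual r ts us) →
    Any (λ t → p ∈ names t × q ∈ names t) (argumentsᵉ (activePair r ts us))
  residual⁻ (α [ vs ]⋈ β [ ws ]) ts us p∉ q∉ co with Any.++⁻ (toList (zipWith _≐_ ts vs)) co
  ... | inj₁ co₁ = Any.++⁺ˡ (zipWith⁻ ts vs (p∉ ∘ ∈-++⁺ˡ) (q∉ ∘ ∈-++⁺ˡ) co₁)
  ... | inj₂ co₂ = Any.++⁺ʳ (toList ts)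
    (zipWith⁻ us ws (p∉ ∘ ∈-++⁺ʳ (namesᵛ vs)) (q∉ ∘ ∈-++⁺ʳ (namesᵛ vs)) co₂)

  residual⁺ : ∀ r ts us → Any (λ t → p ∈ names t × q ∈ names t) (argumentsᵉ (activePair r ts us)) →
    Any (λ e → p ∈ namesᵉ e × q ∈ namesᵉ e) (residual r ts us)
  residual⁺ (α [ vs ]⋈ β [ ws ]) ts us co with Any.++⁻ (toList ts) co
  ... | inj₁ co₁ = Any.++⁺ˡ (zipWith⁺ ts vs co₁)
  ... | inj₂ co₂ = Any.++⁺ʳ (toList (zipWith _≐_ ts vs)) (zipWith⁺ us ws co₂)

  -- Separation and free names across an indirection.

  m≡1⇒n≡0 : ∀ {m n} → 1 ≤ m → m + n ≡ 1 → n ≡ 0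
  m≡1⇒n≡0 {suc zero} _ refl = refl
  m≡1⇒n≡0 {suc (suc m)} _ ()

  recolour-fresh : ∀ {κ k} e → x ∉ namesᵉ e → Monochromatic κ (subᵉ (x ↦ u) e) → Monochromatic (update κ x k) e
  recolour-fresh {κ = κ} {k} e x∉e (j , κ≡j) = j , λ z∈ → let z≢x = λ { refl → x∉e z∈ } in
    trans (update-other κ k z≢x) (κ≡j (∈-renameᵉ⁺ e z∈ z≢x))

  recolour-bound : ∀ {κ} e → x ∈ namesᵉ e → ((k , _) : Monochromatic κ (subᵉ (x ↦ u) e)) →
                   (∀ {z} → z ∈ names u → κ z ≡ k) × Monochromatic (update κ x k) e
  recolour-bound {x = x} {u = u} {κ = κ} e x∈e (k , κ≡k) =
    (λ z∈ → κ≡k (subst (_ ∈_) (sym (namesᵉ-sub _ e)) (∈-↦⁺-same x∈e z∈))) , k , helper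
    where
    helper : z ∈ namesᵉ e → update κ x k z ≡ k
    helper {z = z} z∈ with z ≟ x
    ... | yes _   = refl
    ... | no  z≢x = κ≡k (∈-renameᵉ⁺ e z∈ z≢x)

  -- The only equation of `Θ` containing `x` has absorbed all of `u`. Its colour is therefore the
  -- colour of every name of `u` and the right one for `x`; the other equations do not contain `x`
  -- and keep their colours.
  recolour : ∀ {κ} Θ → occurrences x (namesᵐ Θ) ≡ 1 → All (Monochromatic κ) (map (subᵉ (x ↦ u)) Θ) →
             ∃[ k ] (∀ {z} → z ∈ names u → κ z ≡ k) × All (Monochromatic (update κ x k)) Θ
  recolour {x = x} {u = u} {κ = κ} (e ∷ Θ) occ≡1 (mono ∷ monos) with x ∈? namesᵉ e
  ... | yes x∈e = let κ≡k , mono′ = recolour-bound {u = u} {κ = κ} e x∈e mono in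
    proj₁ mono , κ≡k , mono′ ∷
    All.tabulate λ {e′} e′∈ → recolour-fresh e′ (x∉Θ ∘ λ x∈ → ∈-concatMap⁺ namesᵉ (lose e′∈ x∈))
                                 (All.lookup (All.map⁻ monos) e′∈)
    where
    x∉Θ : x ∉ namesᵐ Θ
    x∉Θ = occ≡0⇒∉ (m≡1⇒n≡0 (occ-∈ x∈e) (trans (sym (occ-++ x (namesᵉ e) (namesᵐ Θ))) occ≡1))
  ... | no x∉e =
    let occ-Θ = trans (cong (_+ occurrences x (namesᵐ Θ)) (sym (occ-∉ (namesᵉ e) x∉e)))
                      (trans (sym (occ-++ x (namesᵉ e) (namesᵐ Θ))) occ≡1)
        k , κ≡k , monos′ = recolour Θ occ-Θ monos
    in k , κ≡k , recolour-fresh e x∉e mono ∷ monos′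

  -- Were x to occur twice in Θ, replacing it by a closed u could disconnect equations.
  occ-indirection : ∀ {f} → Linear ⟨ f ∣ (name x ≐ u) ∷ Θ ⟩ → x ∉ names u → x ∈ namesᶜ ⟨ f ∣ Θ ⟩ →
                    occurrences x (namesᶜ ⟨ f ∣ Θ ⟩) ≡ 1
  occ-indirection {x = x} {u = u} {Θ = Θ} {f = f} lin x∉u x∈ = ℕ.≤-antisym
    (ℕ.≤-pred (subst (_≤ 2) (trans (occ-∷ x f (name x ≐ u) Θ)
      (cong (_+ _) (trans (occ-here x (names u)) (cong suc (occ-∉ (names u) x∉u))))) (lin x)))
    (occ-∈ x∈)

  -- The step eliminates `x`, so a name present afterwards is not `x`. Since `x` occurs exactly once
  -- outside its equation, `u` is moved without duplication or loss, and the count of `p` is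
  -- unchanged.
  Free-indirection : ∀ {f} → Linear ⟨ f ∣ (name x ≐ u) ∷ Θ ⟩ → x ∉ names u → x ∈ namesᶜ ⟨ f ∣ Θ ⟩ →
                     Free p (subᶜ (x ↦ u) ⟨ f ∣ Θ ⟩) → p ≢ x × Free p ⟨ f ∣ (name x ≐ u) ∷ Θ ⟩
  Free-indirection {x = x} {u = u} {Θ = Θ} {p = p} {f = f} lin x∉u x∈ free = p≢x , free′
    where
    c₀ = ⟨ f ∣ Θ ⟩
    p≢x : p ≢ x
    p≢x refl with trans (sym free)
                    (trans (cong (occurrences p) (namesᶜ-sub (x ↦ u) c₀)) (occ-↦-self (namesᶜ c₀) x∉u))
    ... | ()
    counted : occurrences p (namesᶜ c₀) + 1 * occurrences p (names u) ≡ 1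
    counted = subst (λ n → occurrences p (namesᶜ c₀) + n * occurrences p (names u) ≡ 1)
      (occ-indirection {u = u} {Θ = Θ} {f = f} lin x∉u x∈)
      (trans (sym (trans (cong (occurrences p) (namesᶜ-sub (x ↦ u) c₀)) (occ-↦ (namesᶜ c₀) p≢x))) free)
    free′ : Free p ⟨ f ∣ (name x ≐ u) ∷ Θ ⟩
    free′ = trans (occ-∷ p f (name x ≐ u) Θ)
      (trans (cong (_+ occurrences p (namesᶜ c₀)) (occ-there (names u) p≢x))
      (trans (ℕ.+-comm (occurrences p (names u)) _)
      (trans (cong (occurrences p (namesᶜ c₀) +_) (sym (ℕ.*-identityˡ _))) counted)))

  -- The restored equation between `x` and `u` takes the colour of the equation into which `u` had
  -- been substituted, as found by `recolour`.
  Separated-indirection⁻ : ∀ {f} → Linear ⟨ f ∣ (name x ≐ u) ∷ Θ ⟩ → x ∉ names u → x ∈ namesᶜ ⟨ f ∣ Θ ⟩ →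
    p ≢ x → q ≢ x → Separated p q (subᶜ (x ↦ u) ⟨ f ∣ Θ ⟩) → Separated p q ⟨ f ∣ (name x ≐ u) ∷ Θ ⟩
  Separated-indirection⁻ {x = x} {u = u} {Θ = Θ} {f = []} lin x∉u x∈ p≢x q≢x (κ , _ , monos , κp , κq) =
    let k , κ≡k , monos′ = recolour {u = u} Θ (occ-indirection {u = u} {Θ = Θ} {f = []} lin x∉u x∈) monos in
    update κ x k , refl , (k , head-colour κ≡k) ∷ monos′ ,
    trans (update-other κ k p≢x) κp , trans (update-other κ k q≢x) κq
    where
    head-colour : ∀ {k} → (∀ {z} → z ∈ names u → κ z ≡ k) → ∀ {z} → z ∈ x ∷ names u → update κ x k z ≡ k
    head-colour {k} κ≡k (here refl) = update-same κ x k
    head-colour {k} κ≡k (there z∈u) = trans (update-other κ k λ { refl → x∉u z∈u }) (κ≡k z∈u)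

  -- The same colouring works: the removed equation gave the names of `u` the colour of `x`, which
  -- is the colour of the equation that receives `u`.
  Separated-indirection⁺ : ∀ {f} → Separated p q ⟨ f ∣ (name x ≐ u) ∷ Θ ⟩ → Separated p q (subᶜ (x ↦ u) ⟨ f ∣ Θ ⟩)
  Separated-indirection⁺ {x = x} {u = u} {f = []} (κ , _ , (j , κ≡j) ∷ monos , κp , κq) =
    κ , refl , All.map⁺ (All.map (λ {e} → keep e) monos) , κp , κq
    where
    keep : ∀ e → Monochromatic κ e → Monochromatic κ (subᵉ (x ↦ u) e)
    keep e (k , κ≡k) = k , λ z∈ → helper (∈-↦⁻ (namesᵉ e) (subst (_ ∈_) (namesᵉ-sub _ e) z∈))
      where
      helper : (z ∈ namesᵉ e × z ≢ x) ⊎ (x ∈ namesᵉ e × z ∈ names u) → κ z ≡ k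
      helper (inj₁ (z∈e , _))   = κ≡k z∈e
      helper (inj₂ (x∈e , z∈u)) = trans (κ≡j (there z∈u)) (trans (sym (κ≡j (here refl))) (κ≡k x∈e))

  -- Separation and free names across an interaction.

  paint : List Name → Bool → Colouring → Colouring
  paint L k κ z with z ∈? L
  ... | yes _ = k
  ... | no  _ = κ z

  paint-∈ : ∀ κ k → z ∈ L → paint L k κ z ≡ k
  paint-∈ {z = z} {L = L} κ k z∈L with z ∈? L
  ... | yes _   = refl
  ... | no  z∉L = contradiction z∈L z∉L

  paint-∉ : ∀ κ k → z ∉ L → paint L k κ z ≡ κ z
  paint-∉ {z = z} {L = L} κ k z∉L with z ∈? L
  ... | yes z∈L = contradiction z∈L z∉L
  ... | no  _   = refl

  -- All names of the residual come from the active pair, which has one colour `k`, or from the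
  -- rule. The latter are fresh, so they can be painted `k` without disturbing the rest of the
  -- configuration, in particular `p` and `q`.
  Separated-interaction : ∀ {f} r ts us → let c = ⟨ f ∣ activePair r ts us ∷ Θ ⟩ in
    (∀ {z} → z ∈ namesʳ r → z ∉ namesᶜ c) → p ∈ namesᶜ c → q ∈ namesᶜ c →
    Separated p q c → Separated p q ⟨ f ∣ residual r ts us ++ Θ ⟩
  Separated-interaction {Θ = Θ} {f = []} r ts us fresh p∈ q∈ (κ , _ , (k , κ≡k) ∷ monos , κp , κq) =
    κ′ , refl , All.++⁺ (All.tabulate in-residual) (All.tabulate in-Θ) ,
    trans (keep p∈) κp , trans (keep q∈) κq
    where
    κ′ = paint (namesʳ r) k κ
    keep : z ∈ namesᶜ ⟨ [] ∣ activePair r ts us ∷ Θ ⟩ → κ′ z ≡ κ z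
    keep z∈ = paint-∉ κ k λ z∈r → fresh z∈r z∈
    in-residual : ∀ {e} → e ∈ residual r ts us → Monochromatic κ′ e
    in-residual e∈ = k , λ z∈ → helper (∈-residual r ts us (∈-concatMap⁺ namesᵉ (lose e∈ z∈)))
      where
      helper : z ∈ namesᵉ (activePair r ts us) ⊎ z ∈ namesʳ r → κ′ z ≡ k
      helper (inj₁ z∈e) = trans (keep (∈-++⁺ˡ z∈e)) (κ≡k z∈e)
      helper (inj₂ z∈r) = paint-∈ κ k z∈r
    in-Θ : ∀ {e} → e ∈ Θ → Monochromatic κ′ e
    in-Θ e∈ with All.lookup monos e∈
    ... | j , κ≡j = j , λ z∈ → trans (keep (∈-namesᶜ {Δ = activePair r ts us ∷ Θ} [] (there e∈) z∈)) (κ≡j z∈)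

  -- A name of the rule occurs twice in the residual already, so a name with a single occurrence is
  -- foreign to the rule. Its count then agrees on both sides, because the arguments are only
  -- redistributed.
  Free-interaction : ∀ {f} r ts us → LinearRule r → Free p ⟨ f ∣ residual r ts us ++ Θ ⟩ →
                     p ∉ namesʳ r × Free p ⟨ f ∣ activePair r ts us ∷ Θ ⟩
  Free-interaction {p = p} {Θ = Θ} {f = f} r ts us linear free = p∉r , trans (occ-∷ p f (activePair r ts us) Θ)
    (trans (cong (_+ _) (trans (sym (ℕ.+-identityʳ _))
                               (cong (occurrences p (namesᵉ (activePair r ts us)) +_) (sym (occ-∉ _ p∉r)))))
           counted)
    where
    counted : occurrences p (namesᵉ (activePair r ts us)) + occurrences p (namesʳ r) +
              occurrences p (namesᶜ ⟨ f ∣ Θ ⟩) ≡ 1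
    counted = trans (cong (_+ _) (sym (occ-residual p r ts us)))
                    (trans (sym (occ-++ᵐ p f (residual r ts us) Θ)) free)
    p∉r : p ∉ namesʳ r
    p∉r p∈r with subst (2 ≤_) counted
      (ℕ.≤-trans (ℕ.≤-reflexive (sym (linear p∈r)))
        (ℕ.≤-trans (ℕ.m≤n+m _ (occurrences p (namesᵉ (activePair r ts us)))) (ℕ.m≤m+n _ _)))
    ... | s≤s ()

  LinearRule-rename : ∀ r → Injective _≡_ _≡_ ρ → LinearRule r → LinearRule (renameʳ {S = S} ρ r)
  LinearRule-rename {ρ = ρ} r inj linear {x} x∈ with ∈-map⁻ ρ (subst (x ∈_) (namesʳ-rename ρ r) x∈)
  ... | w , w∈ , refl =
    trans (cong (occurrences x) (namesʳ-rename ρ r)) (trans (occ-map-injective inj w (namesʳ r)) (linear w∈))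

  -- An interaction that puts p next to q but not next to q′ acts on the only equation containing p
  -- as soon as that equation contains q′; the pair p, q then lies inside an argument, but p, q′ does not.
  interaction-backward : ∀ {f q′} r ts us → LinearRule r →
    let c = ⟨ f ∣ activePair r ts us ∷ Θ ⟩ ; c′ = ⟨ f ∣ residual r ts us ++ Θ ⟩ in
    Free p c′ → Free q c′ → Cooccur p q c′ → ¬ Cooccur p q′ c′ →
    Cooccur p q c × (Cooccur p q′ c → Coargument p q c) × ¬ Coargument p q′ c
  interaction-backward {Θ = Θ} {p = p} {q = q} {f = f} {q′ = q′} r ts us linear free-p free-q co ¬co′ =
    co-c , coarg , ¬coarg
    where
    e₀ = activePair r ts us
    p∉r = proj₁ (Free-interaction {Θ = Θ} {f = f} r ts us linear free-p)
    q∉r = proj₁ (Free-interaction {Θ = Θ} {f = f} r ts us linear free-q)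
    in-residual : Any (λ e → p ∈ namesᵉ e × q ∈ namesᵉ e) (residual r ts us) →
                  Any (λ t → p ∈ names t × q ∈ names t) (argumentsᵉ e₀)
    in-residual = residual⁻ r ts us p∉r q∉r
    co-c : Cooccur p q ⟨ f ∣ e₀ ∷ Θ ⟩
    co-c with Any.++⁻ (residual r ts us) co
    ... | inj₁ co-r = here (argumentsᵉ⊆ e₀ (Any.map proj₁ (in-residual co-r)) ,
                            argumentsᵉ⊆ e₀ (Any.map proj₂ (in-residual co-r)))
    ... | inj₂ co-Θ = there co-Θ
    p∉Θ : p ∈ namesᵉ e₀ → p ∉ namesᶜ ⟨ f ∣ Θ ⟩
    p∉Θ p∈e = occ≡0⇒∉ (m≡1⇒n≡0 (occ-∈ p∈e)
      (trans (sym (occ-∷ p f e₀ Θ)) (proj₂ (Free-interaction {Θ = Θ} {f = f} r ts us linear free-p))))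
    coarg : Cooccur p q′ ⟨ f ∣ e₀ ∷ Θ ⟩ → Coargument p q ⟨ f ∣ e₀ ∷ Θ ⟩
    coarg (there co′) = contradiction (Any.++⁺ʳ (residual r ts us) co′) ¬co′
    coarg (here (p∈e , _)) with Any.++⁻ (residual r ts us) co
    ... | inj₁ co-r = here (in-residual co-r)
    ... | inj₂ co-Θ with find co-Θ
    ...   | e′ , e′∈ , p∈e′ , _ = contradiction (∈-namesᶜ f e′∈ p∈e′) (p∉Θ p∈e)
    ¬coarg : ¬ Coargument p q′ ⟨ f ∣ e₀ ∷ Θ ⟩
    ¬coarg (here co′)  = ¬co′ (Any.++⁺ˡ (residual⁺ r ts us co′))
    ¬coarg (there co′) = ¬co′ (Any.++⁺ʳ (residual r ts us)
      (Any.map (λ {e} any → argumentsᵉ⊆ e (Any.map proj₁ any) , argumentsᵉ⊆ e (Any.map proj₂ any)) co′))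

-- Excluding a common predecessor.

module _ (I : InteractionSystem a ℓ) where
  open InteractionSystem I renaming (signature to S; linear to linearRule)
  open Configuration using (raw)
  open Signature S

  private
    variable
      c c′ d d′ s s₁ s₂ : RawConfiguration S

  fresh-rename : ∀ {r : RawRule S} (ρ : Name → Name) → (∀ {x} → x ∈ namesʳ r → ρ x ∉ namesᶜ c) →
                 ∀ {z} → z ∈ namesʳ (renameʳ ρ r) → z ∉ namesᶜ c
  fresh-rename {r = r} ρ fresh {z} z∈ with ∈-map⁻ ρ (subst (z ∈_) (namesʳ-rename ρ r) z∈)
  ... | w , w∈ , refl = fresh w∈

  Separated-step : RawStep I c c′ → Free p c → Free q c → Separated p q c → Separated p q c′
  Separated-step (interaction {r = r} {f = f} {Δ = Δ} {ts} {us} ρ _ _ fresh) free-p free-q =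
    Separated-interaction {Θ = Δ} {f = f} (renameʳ ρ r) ts us
      (fresh-rename {c = ⟨ f ∣ activePair r ts us ∷ Δ ⟩} {r = r} ρ fresh) (occ≡suc⇒∈ free-p) (occ≡suc⇒∈ free-q)
  Separated-step (indirection {f = f} _ _) _ _ = Separated-indirection⁺ {f = f}

  -- Separation in `s₁` is pulled back through the indirection, carried over to the source `d` of
  -- the other step, and pushed forward to `d′` by a step of either kind. There it contradicts the
  -- co-occurrence in `s₂`.
  indirection-excluded : ∀ {f Δ x u} → Linear s → Free p s₁ → Free q s₁ → Separated p q s₁ →
    Cooccur p q s₂ → Free p s₂ → Free q s₂ →
    x ∉ names u → x ∈ namesᶜ ⟨ f ∣ Δ ⟩ → s ≈ ⟨ f ∣ (name x ≐ u) ∷ Δ ⟩ → subᶜ (x ↦ u) ⟨ f ∣ Δ ⟩ ≈ s₁ →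
    RawStep I d d′ → s ≈ d → d′ ≈ s₂ → ⊥
  indirection-excluded {s₁ = s₁} {d = d} {d′} {f = f} {Δ} {x} {u} linear
    free-p free-q separated co free-p₂ free-q₂ x∉u x∈ s≈c c′≈s₁ step s≈d d′≈s₂ =
    Separated⇒¬Cooccur {c = d′}
      (Separated-step step (Free-≈ c≈d (proj₂ p-c)) (Free-≈ c≈d (proj₂ q-c)) separated-d)
      (Cooccur-≈ (≈-sym d′≈s₂) free-p₂ free-q₂ co)
    where
    linear-c = Linear-≈ s≈c linear
    c≈d = EqClosure.transitive _ (≈-sym s≈c) s≈d
    backward : ∀ {p} → Free p s₁ → p ≢ x × Free p ⟨ f ∣ (name x ≐ u) ∷ Δ ⟩
    backward free = Free-indirection {u = u} {Θ = Δ} {f = f} linear-c x∉u x∈ (Free-≈ (≈-sym c′≈s₁) free)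
    p-c = backward free-p
    q-c = backward free-q
    separated-d : Separated _ _ d
    separated-d = Separated-≈ c≈d (proj₂ p-c) (proj₂ q-c)
      (Separated-indirection⁻ {u = u} {Θ = Δ} {f = f} linear-c x∉u x∈ (proj₁ p-c) (proj₁ q-c)
        (Separated-≈ (≈-sym c′≈s₁) free-p free-q separated))

  InteractionBackward : Name → Name → Name → RawConfiguration S → Set a
  InteractionBackward p q q′ c =
    Free p c × Free q c × Cooccur p q c × (Cooccur p q′ c → Coargument p q c) × ¬ Coargument p q′ c

  interaction-step-backward : ∀ {r f Δ ts us} ρ → IsRule r → Injective _≡_ _≡_ ρ →
    let c′ = ⟨ f ∣ residual (renameʳ ρ r) ts us ++ Δ ⟩ in
    c′ ≈ s → Free p s → Free q s → Free z s → Cooccur p q s → Separated p z s →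
    InteractionBackward p q z ⟨ f ∣ activePair r ts us ∷ Δ ⟩
  interaction-step-backward {s = s} {r = r} {f} {Δ} {ts} {us} ρ isRule inj c′≈s
    free-p free-q free-z co separated =
    proj₂ (free free-p′) , proj₂ (free free-q′) ,
    interaction-backward {Θ = Δ} {f = f} (renameʳ ρ r) ts us linear free-p′ free-q′
      (Cooccur-≈ (≈-sym c′≈s) free-p free-q co)
      (Separated⇒¬Cooccur {c = s} separated ∘ Cooccur-≈ c′≈s free-p′ (Free-≈ (≈-sym c′≈s) free-z))
    where
    free-p′ = Free-≈ (≈-sym c′≈s) free-p
    free-q′ = Free-≈ (≈-sym c′≈s) free-q
    linear : LinearRule (renameʳ ρ r)
    linear = LinearRule-rename r inj (linearRule isRule)
    free : ∀ {p} → Free p ⟨ f ∣ residual (renameʳ ρ r) ts us ++ Δ ⟩ → _ × Free p ⟨ f ∣ activePair r ts us ∷ Δ ⟩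
    free = Free-interaction {Θ = Δ} {f = f} (renameʳ ρ r) ts us linear

  no-common-predecessor : ∀ (s′ s₁ s₂ : Configuration S) →
    (∀ {w} → w ∈ p ∷ q ∷ z ∷ [] → Free w (raw s₁) × Free w (raw s₂)) →
    Cooccur p q (raw s₁) → Separated p z (raw s₁) → Cooccur p z (raw s₂) → Separated p q (raw s₂) →
    Step I s′ s₁ → Step I s′ s₂ → ⊥
  no-common-predecessor s′ s₁ s₂ free co₁ sep₁ co₂ sep₂
    (_ , _ , s≈c , step₁ , c′≈) (_ , _ , s≈d , step₂ , d′≈) =
    helper step₁ c′≈ step₂ d′≈ s≈c s≈d
    where
    linear = Configuration.linear s′
    free-p = free (here refl)
    free-q = free (there (here refl))
    free-z = free (there (there (here refl)))
    helper : RawStep I c c′ → c′ ≈ raw s₁ → RawStep I d d′ → d′ ≈ raw s₂ →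
             raw s′ ≈ c → raw s′ ≈ d → ⊥
    helper (indirection x∉u x∈) c′≈ step₂ d′≈ s≈c s≈d =
      indirection-excluded linear (proj₁ free-p) (proj₁ free-z) sep₁ co₂ (proj₂ free-p) (proj₂ free-z)
        x∉u x∈ s≈c c′≈ step₂ s≈d d′≈
    -- The mirror image of the previous case: the two configurations and the names `q` and `z`
    -- exchange roles.
    helper step₁@(interaction _ _ _ _) c′≈ (indirection x∉u x∈) d′≈ s≈c s≈d =
      indirection-excluded linear (proj₂ free-p) (proj₂ free-q) sep₂ co₁ (proj₁ free-p) (proj₁ free-q)
        x∉u x∈ s≈d d′≈ step₁ s≈c c′≈
    helper (interaction {f = f₁} {Δ₁} ρ₁ rule₁ injective₁ _) c′≈
           (interaction {f = f₂} {Δ₂} ρ₂ rule₂ injective₂ _) d′≈ s≈c s≈d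
      with interaction-step-backward {f = f₁} {Δ₁} ρ₁ rule₁ injective₁ c′≈
             (proj₁ free-p) (proj₁ free-q) (proj₁ free-z) co₁ sep₁
         | interaction-step-backward {f = f₂} {Δ₂} ρ₂ rule₂ injective₂ d′≈
             (proj₂ free-p) (proj₂ free-z) (proj₂ free-q) co₂ sep₂
    -- The second step shows that `p` and `z` share an equation of the predecessor. With this the
    -- first step places `p` and `q` in one argument, which the second step forbids.
    ... | free-p-c , free-q-c , _ , coarg , _ | free-p-d , free-z-d , co-d , _ , ¬coarg =
      ¬coarg (Coargument-≈ c≈d free-p-c free-q-c (coarg (Cooccur-≈ (≈-sym c≈d) free-p-d free-z-d co-d)))
      where c≈d = EqClosure.transitive _ (≈-sym s≈c) s≈d

-- Two disjoint copies of the names: the even and the odd numbers.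

code : Bool → Name → Name
code true  zero    = 0
code false zero    = 1
code k     (suc z) = suc (suc (code k z))

-- `code true z` is 2z and `code false z` is 2z+1, so the copy is recovered as the parity and the
-- original name as the half rounded down.
tag : Name → Bool
tag zero          = true
tag (suc zero)    = false
tag (suc (suc z)) = tag z

untag : Name → Name
untag (suc (suc z)) = suc (untag z)
untag _             = zero

tag-code : ∀ k z → tag (code k z) ≡ k
tag-code true  zero    = refl
tag-code false zero    = refl
tag-code true  (suc z) = tag-code true z
tag-code false (suc z) = tag-code false z

untag-code : ∀ k z → untag (code k z) ≡ z
untag-code true  zero    = refl
untag-code false zero    = refl
untag-code true  (suc z) = cong suc (untag-code true z)
untag-code false (suc z) = cong suc (untag-code false z)

-- The function `χ` chooses for each name which of its two copies to use, and `not ∘ χ` makes the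
-- complementary choice. A constant `χ` gives the two plain copies, a non-constant one mixes them.
copy : (Name → Bool) → Name → Name
copy χ z = code (χ z) z

copy-injective : ∀ χ → Injective _≡_ _≡_ (copy χ)
copy-injective χ {x} {y} eq = trans (sym (untag-code (χ x) x)) (trans (cong untag eq) (untag-code (χ y) y))

-- Equal values would have the same original name, but complementary choices give it different tags.
copy-disjoint : ∀ χ z w → copy χ z ≢ copy (not ∘ χ) w
copy-disjoint χ z w eq with trans (sym (untag-code (χ z) z)) (trans (cong untag eq) (untag-code (not (χ w)) w))
... | refl with χ z | trans (sym (tag-code (χ z) z)) (trans (cong tag eq) (tag-code (not (χ z)) z))
...   | true  | ()
...   | false | ()

copy∉ : ∀ χ z L → copy χ z ∉ map (copy (not ∘ χ)) L
copy∉ χ z L z∈ with ∈-map⁻ _ z∈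
... | w , _ , eq = copy-disjoint χ z w eq

cocopy∉ : ∀ χ z L → copy (not ∘ χ) z ∉ map (copy χ) L
cocopy∉ χ z L z∈ with ∈-map⁻ _ z∈
... | w , _ , eq = copy-disjoint χ w z (sym eq)

occ-copy : ∀ χ z L M →
           occurrences (copy χ z) (map (copy χ) L ++ map (copy (not ∘ χ)) M) ≡ occurrences z L
occ-copy χ z L M = trans (occ-++ (copy χ z) (map (copy χ) L) _)
  (trans (cong₂ _+_ (occ-map-injective (copy-injective χ) z L) (occ-∉ _ (copy∉ χ z M))) (ℕ.+-identityʳ _))

occ-cocopy : ∀ χ z L M →
             occurrences (copy (not ∘ χ) z) (map (copy χ) L ++ map (copy (not ∘ χ)) M) ≡ occurrences z M
occ-cocopy χ z L M = trans (occ-++ (copy (not ∘ χ) z) (map (copy χ) L) _)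
  (cong₂ _+_ (occ-∉ _ (cocopy∉ χ z L)) (occ-map-injective (copy-injective (not ∘ χ)) z M))

occ-copies≤ : ∀ χ n L M → (∀ z → occurrences z L ≤ n) → (∀ z → occurrences z M ≤ n) →
              ∀ z → occurrences z (map (copy χ) L ++ map (copy (not ∘ χ)) M) ≤ n
occ-copies≤ χ n L M L≤n M≤n z with z ∈? (map (copy χ) L ++ map (copy (not ∘ χ)) M)
... | no  z∉ = subst (_≤ n) (sym (occ-∉ _ z∉)) z≤n
... | yes z∈ with ∈-++⁻ (map (copy χ) L) z∈
...   | inj₁ z∈L with ∈-map⁻ _ z∈L
...     | w , _ , refl = subst (_≤ n) (sym (occ-copy χ w L M)) (L≤n w)
occ-copies≤ χ n L M L≤n M≤n z | yes z∈ | inj₂ z∈M with ∈-map⁻ _ z∈M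
...     | w , _ , refl = subst (_≤ n) (sym (occ-cocopy χ w L M)) (M≤n w)

code-copy : ∀ χ k z → code k z ≡ copy χ z ⊎ code k z ≡ copy (not ∘ χ) z
code-copy χ k z with χ z
code-copy χ true  z | true  = inj₁ refl
code-copy χ true  z | false = inj₂ refl
code-copy χ false z | true  = inj₂ refl
code-copy χ false z | false = inj₁ refl

-- Whatever `χ` is, `code k z` lies in one of the two complementary copies. This allows the same
-- names to address ports in configurations built from different `χ`.
occ≡1-copies : ∀ χ k L M → occurrences z L ≡ 1 → occurrences z M ≡ 1 →
               occurrences (code k z) (map (copy χ) L ++ map (copy (not ∘ χ)) M) ≡ 1
occ≡1-copies {z = z} χ k L M L≡1 M≡1 with code-copy χ k z
... | inj₁ eq rewrite eq = trans (occ-copy χ z L M) L≡1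
... | inj₂ eq rewrite eq = trans (occ-cocopy χ z L M) M≡1

-- Tests whether the tag of a name is the one chosen by `χ`, that is, whether the name is in the
-- image of `copy χ`.
copyColouring : (Name → Bool) → Name → Bool
copyColouring χ z = not (tag z xor χ (untag z))

copyColouring-copy : ∀ χ z → copyColouring χ (copy χ z) ≡ true
copyColouring-copy χ z rewrite tag-code (χ z) z | untag-code (χ z) z with χ z
... | true  = refl
... | false = refl

copyColouring-cocopy : ∀ χ z → copyColouring χ (copy (not ∘ χ) z) ≡ false
copyColouring-cocopy χ z rewrite tag-code (not (χ z)) z | untag-code (not (χ z)) z with χ z
... | true  = refl
... | false = refl

-- Configurations made of two copies of a rule.

module _ {S : Signature a} where
  open Signature S

  namesᵛ-name : ∀ {n} (xs : Vec Name n) → namesᵛ {S = S} (Vec.map name xs) ≡ toList xs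
  namesᵛ-name []       = refl
  namesᵛ-name (x ∷ xs) = cong (x ∷_) (namesᵛ-name xs)

  residual-rename : ∀ ρ (r : RawRule S) ts us →
    residual (renameʳ ρ r) (subᵛ (rename ρ) ts) (subᵛ (rename ρ) us) ≡ map (subᵉ (rename ρ)) (residual r ts us)
  residual-rename ρ (α [ vs ]⋈ β [ ws ]) ts us =
    trans (cong₂ _++_ (zipWith-rename ts vs) (zipWith-rename us ws))
          (sym (map-++ (subᵉ (rename ρ)) (toList (zipWith _≐_ ts vs)) _))
    where
    zipWith-rename : ∀ {n} (ts vs : Vec (Term S) n) →
      toList (zipWith _≐_ (subᵛ (rename ρ) ts) (subᵛ (rename ρ) vs)) ≡
      map (subᵉ (rename ρ)) (toList (zipWith _≐_ ts vs))
    zipWith-rename []       []       = refl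
    zipWith-rename (t ∷ ts) (v ∷ vs) = cong (_ ∷_) (zipWith-rename ts vs)

  subᵉ-≈ᵉ : ∀ (σ : Substitution {S = S}) {e e′} → e ≈ᵉ e′ → subᵉ σ e ≈ᵉ subᵉ σ e′
  subᵉ-≈ᵉ σ same = same
  subᵉ-≈ᵉ σ flip = flip

  map-subᵉ-cong : ∀ {σ τ : Substitution {S = S}} Δ → (∀ {z} → z ∈ namesᵐ Δ → σ z ≡ τ z) →
                  map (subᵉ σ) Δ ≡ map (subᵉ τ) Δ
  map-subᵉ-cong []            eq = refl
  map-subᵉ-cong ((t ≐ u) ∷ Δ) eq = cong₂ _∷_
    (cong₂ _≐_ (sub-cong t (eq ∘ ∈-++⁺ˡ ∘ ∈-++⁺ˡ)) (sub-cong u (eq ∘ ∈-++⁺ˡ ∘ ∈-++⁺ʳ (names t))))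
    (map-subᵉ-cong Δ (eq ∘ ∈-++⁺ʳ (namesᵉ (t ≐ u))))

  module Copies (r : RawRule S) (linear : LinearRule r)
                (xs : Vec Name (ar (RawRule.left r))) (ys : Vec Name (ar (RawRule.right r)))
                (unique : Unique (toList xs ++ toList ys))
                (disjoint : Disjoint (toList xs ++ toList ys) (namesʳ r)) where

    ports : List Name
    ports = toList xs ++ toList ys

    pair : Equation S
    pair = activePair r (Vec.map name xs) (Vec.map name ys)

    rest : List (Equation S)
    rest = residual r (Vec.map name xs) (Vec.map name ys)

    -- One copy holds the active pair or its residual, the complementary copy a second residual.
    -- Constant `χ` gives the first predecessor, and the characteristic function of the names of `Γ`
    -- the second.
    before after : (Name → Bool) → RawConfiguration S
    before χ = ⟨ [] ∣ subᵉ (rename (copy χ)) pair ∷ map (subᵉ (rename (copy (not ∘ χ)))) rest ⟩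
    after χ  = ⟨ [] ∣ map (subᵉ (rename (copy χ))) rest ++ map (subᵉ (rename (copy (not ∘ χ)))) rest ⟩

    names-pair : namesᵉ pair ≡ ports
    names-pair = cong₂ _++_ (namesᵛ-name xs) (namesᵛ-name ys)

    names-before : ∀ χ → namesᶜ (before χ) ≡ map (copy χ) ports ++ map (copy (not ∘ χ)) (namesᵐ rest)
    names-before χ = cong₂ _++_ (trans (namesᵉ-rename (copy χ) pair) (cong (map (copy χ)) names-pair))
                                (namesᵐ-rename (copy (not ∘ χ)) rest)

    names-after : ∀ χ → namesᶜ (after χ) ≡ map (copy χ) (namesᵐ rest) ++ map (copy (not ∘ χ)) (namesᵐ rest)
    names-after χ = trans (concatMap-++ namesᵉ (map (subᵉ (rename (copy χ))) rest) _)
      (cong₂ _++_ (namesᵐ-rename (copy χ) rest) (namesᵐ-rename (copy (not ∘ χ)) rest))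

    occ-rest : ∀ z → occurrences z (namesᵐ rest) ≡ occurrences z ports + occurrences z (namesʳ r)
    occ-rest z = trans (occ-residual z r (Vec.map name xs) (Vec.map name ys))
                       (cong (λ L → occurrences z L + _) names-pair)

    occ-port : z ∈ ports → occurrences z ports ≡ 1
    occ-port = occ-Unique unique

    occ-port-rest : z ∈ ports → occurrences z (namesᵐ rest) ≡ 1
    occ-port-rest {z = z} z∈ = trans (occ-rest z)
      (cong₂ _+_ (occ-port z∈) (occ-∉ (namesʳ r) λ z∈r → disjoint (z∈ , z∈r)))

    occ-ports≤2 : ∀ z → occurrences z ports ≤ 2
    occ-ports≤2 z with z ∈? ports
    ... | yes z∈ = subst (_≤ 2) (sym (occ-port z∈)) (s≤s z≤n)
    ... | no  z∉ = subst (_≤ 2) (sym (occ-∉ ports z∉)) z≤n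

    occ-rest≤2 : ∀ z → occurrences z (namesᵐ rest) ≤ 2
    occ-rest≤2 z with z ∈? ports | z ∈? namesʳ r
    ... | yes z∈ | _      = subst (_≤ 2) (sym (occ-port-rest z∈)) (s≤s z≤n)
    ... | no  z∉ | yes z∈r = ℕ.≤-reflexive (trans (occ-rest z) (cong₂ _+_ (occ-∉ ports z∉) (linear z∈r)))
    ... | no  z∉ | no z∉r = subst (_≤ 2)
      (sym (trans (occ-rest z) (cong₂ _+_ (occ-∉ ports z∉) (occ-∉ (namesʳ r) z∉r)))) z≤n

    beforeᶜ afterᶜ : (Name → Bool) → Configuration S
    beforeᶜ χ = record
      { raw    = before χ
      ; linear = λ z → subst (λ L → occurrences z L ≤ 2) (sym (names-before χ))
                         (occ-copies≤ χ 2 ports (namesᵐ rest) occ-ports≤2 occ-rest≤2 z)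
      }
    afterᶜ χ = record
      { raw    = after χ
      ; linear = λ z → subst (λ L → occurrences z L ≤ 2) (sym (names-after χ))
                         (occ-copies≤ χ 2 (namesᵐ rest) (namesᵐ rest) occ-rest≤2 occ-rest≤2 z)
      }

    Free-before : ∀ χ k → z ∈ ports → Free (code k z) (before χ)
    Free-before χ k z∈ = trans (cong (occurrences _) (names-before χ))
      (occ≡1-copies χ k ports (namesᵐ rest) (occ-port z∈) (occ-port-rest z∈))

    ∈-before : ∀ χ → z ∈ ports → copy χ z ∈ namesᵉ (subᵉ (rename (copy χ)) pair)
    ∈-before χ z∈ = subst (_ ∈_) (sym (trans (namesᵉ-rename (copy χ) pair) (cong (map (copy χ)) names-pair)))
                               (∈-map⁺ (copy χ) z∈)

    Cooccur-before : ∀ χ → p ∈ ports → q ∈ ports → Cooccur (copy χ p) (copy χ q) (before χ)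
    Cooccur-before χ p∈ q∈ = here (∈-before χ p∈ , ∈-before χ q∈)

    -- The active pair and the second residual use complementary copies, so colouring by copy is
    -- constant on each equation.
    Separated-before : ∀ χ p q → Separated (copy χ p) (copy (not ∘ χ) q) (before χ)
    Separated-before χ p q =
      copyColouring χ , refl ,
      constant (copy χ) (copyColouring-copy χ) pair ∷
        All.map⁺ (All.universal (constant (copy (not ∘ χ)) (copyColouring-cocopy χ)) rest) ,
      copyColouring-copy χ p , copyColouring-cocopy χ q
      where
      constant : ∀ ρ {k} → (∀ z → copyColouring χ (ρ z) ≡ k) → ∀ e →
                 Monochromatic (copyColouring χ) (subᵉ (rename {S = S} ρ) e)
      constant ρ {k} κ≡k e = k , helper
        where
        helper : z ∈ namesᵉ (subᵉ (rename {S = S} ρ) e) → copyColouring χ z ≡ k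
        helper {z = z} z∈ with ∈-map⁻ ρ (subst (z ∈_) (namesᵉ-rename ρ e) z∈)
        ... | w , _ , refl = κ≡k w

    -- Each equation of `rest` has a port as one of its sides, so each non-empty part of a splitting
    -- contributes a port.
    HasPort : Equation S → Set
    HasPort e = ∃[ z ] z ∈ ports × z ∈ namesᵉ e

    HasPort-≈ᵉ : HasPort Respects _≈ᵉ_
    HasPort-≈ᵉ same port = port
    HasPort-≈ᵉ (flip {t} {u}) (z , z∈ , z∈e) = z , z∈ , Any.++-comm (names t) (names u) z∈e

    rest-ports : All HasPort rest
    rest-ports = All.++⁺ (zipWith-ports xs (RawRule.lefts r) ∈-++⁺ˡ)
                         (zipWith-ports ys (RawRule.rights r) (∈-++⁺ʳ (toList xs)))
      where
      zipWith-ports : ∀ {n} (zs : Vec Name n) (vs : Vec (Term S) n) → (∀ {z} → z ∈ toList zs → z ∈ ports) →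
                      All HasPort (toList (zipWith _≐_ (Vec.map name zs) vs))
      zipWith-ports []       []       zs⊆ = []
      zipWith-ports (z ∷ zs) (v ∷ vs) zs⊆ = (z , zs⊆ (here refl) , here refl) ∷ zipWith-ports zs vs (zs⊆ ∘ there)

    nonempty-port : ∀ {Γ} → All HasPort Γ → Γ ≢ [] → ∃[ z ] z ∈ ports × z ∈ namesᵐ Γ
    nonempty-port []                     Γ≢[] = contradiction refl Γ≢[]
    nonempty-port ((z , z∈ , z∈e) ∷ _) _    = z , z∈ , ∈-++⁺ˡ z∈e

    -- Exchanging the parts of a split residual between the copies.

    module Split (Γ Δ : List (Equation S)) (split : rest ≈ᵐ Γ ++ Δ)
                 (disjoint-ΓΔ : Disjoint (namesᵐ Γ) (namesᵐ Δ)) where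

      ports-of : All HasPort (Γ ++ Δ)
      ports-of = PermProperties.All-resp-↭ ≈ᵉ-setoid HasPort-≈ᵉ split rest-ports

      inΓ : Name → Bool
      inΓ z = does (z ∈? namesᵐ Γ)

      inΓ-true : z ∈ namesᵐ Γ → inΓ z ≡ true
      inΓ-true {z = z} z∈ with z ∈? namesᵐ Γ
      ... | yes _  = refl
      ... | no  z∉ = contradiction z∈ z∉

      inΓ-false : z ∈ namesᵐ Δ → inΓ z ≡ false
      inΓ-false {z = z} z∈Δ with z ∈? namesᵐ Γ
      ... | yes z∈Γ = contradiction (z∈Γ , z∈Δ) disjoint-ΓΔ
      ... | no  _   = refl

      map-split : ∀ (σ : Substitution {S = S}) → map (subᵉ σ) rest ≈ᵐ map (subᵉ σ) Γ ++ map (subᵉ σ) Δ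
      map-split σ = subst (map (subᵉ σ) rest ≈ᵐ_) (map-++ (subᵉ σ) Γ Δ)
        (PermProperties.map⁺ ≈ᵉ-setoid ≈ᵉ-setoid (subᵉ-≈ᵉ σ) split)

      -- As `Γ` and `Δ` share no name, `inΓ` is constant on each, and no equation is torn between
      -- the copies. Both sides then consist of two copies of `Γ` and two of `Δ`, in a different
      -- order, and a permutation of the equations suffices.
      after≈after : after inΓ ≈ after (λ _ → true)
      after≈after = EqClosure.return (multiset
        (Perm.trans (PermProperties.++⁺ ≈ᵉ-setoid (recombined inΓ true false inΓ-true inΓ-false)
                     (Perm.trans (recombined (not ∘ inΓ) false true (cong not ∘ inΓ-true) (cong not ∘ inΓ-false))
                       (PermProperties.++-comm ≈ᵉ-setoid (part false Γ) (part true Δ))))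
        (Perm.trans (interchange-++ (part true Γ) (part false Δ) (part true Δ) (part false Γ))
        (Perm.trans (PermProperties.++⁺ˡ ≈ᵉ-setoid (part true Γ ++ part true Δ)
                     (PermProperties.++-comm ≈ᵉ-setoid (part false Δ) (part false Γ)))
          (Perm.sym ≈ᵉ-sym (PermProperties.++⁺ ≈ᵉ-setoid (map-split (rename (code true)))
                                                          (map-split (rename (code false)))))))))
        where
        interchange-++ = CommutativeSemigroupProperties.interchange
          (CommutativeMonoid.commutativeSemigroup (PermProperties.++-commutativeMonoid ≈ᵉ-setoid))
        part : Bool → List (Equation S) → List (Equation S)
        part k = map (subᵉ (rename (code k)))
        recombined : ∀ χ k l → (∀ {z} → z ∈ namesᵐ Γ → χ z ≡ k) → (∀ {z} → z ∈ namesᵐ Δ → χ z ≡ l) →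
                     map (subᵉ (rename (copy χ))) rest ≈ᵐ part k Γ ++ part l Δ
        recombined χ k l Γ≡k Δ≡l = subst (map (subᵉ (rename (copy χ))) rest ≈ᵐ_)
          (cong₂ _++_ (map-subᵉ-cong Γ (λ {z} z∈ → cong (λ k → name (code k z)) (Γ≡k z∈)))
                      (map-subᵉ-cong Δ (λ {z} z∈ → cong (λ k → name (code k z)) (Δ≡l z∈))))
          (map-split (rename (copy χ)))

-- Two steps into one configuration and the contradiction.

proposition5 : ∀ {a ℓ} (I : InteractionSystem a ℓ) → StronglyUpwardConfluent I →
    ∀ {r} → InteractionSystem.IsRule I r → Connected r
proposition5 I confluent {r} isRule (xs , ys , Γ , Δ , unique , disjoint , split , Γ≢[] , Δ≢[] , disjoint-ΓΔ) =
  let _ , g∈ , g∈Γ = nonempty-port (All.++⁻ˡ Γ ports-of) Γ≢[]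
      _ , h∈ , h∈Δ = nonempty-port (All.++⁻ʳ Γ ports-of) Δ≢[]
      s′ , s′→s₁ , s′→s₂ = confluent (beforeᶜ χ₁) (beforeᶜ inΓ) (afterᶜ χ₁)
                             (step χ₁ (afterᶜ χ₁) ε) (step inΓ (afterᶜ χ₁) after≈after)
  in contradictory g∈ g∈Γ h∈ h∈Δ s′ s′→s₁ s′→s₂
  where
  open Copies r (InteractionSystem.linear I isRule) xs ys unique disjoint
  open Split Γ Δ split disjoint-ΓΔ

  χ₁ : Name → Bool
  χ₁ _ = true

  step : ∀ χ s → after χ ≈ Configuration.raw s → Step I (beforeᶜ χ) s
  step χ s after≈s =
    before χ , after χ , ε ,
    -- The rule is instantiated with the same renaming `copy χ` as its ports, so the residual
    -- produced is the renamed `rest`.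
    subst (λ Δ → RawStep I (before χ) ⟨ [] ∣ Δ ++ map (subᵉ (rename (copy (not ∘ χ)))) rest ⟩)
          (residual-rename (copy χ) r (Vec.map name xs) (Vec.map name ys))
          (interaction (copy χ) isRule (copy-injective χ) fresh) ,
    after≈s
    where
    fresh : ∀ {x} → x ∈ namesʳ r → copy χ x ∉ namesᶜ (before χ)
    -- Within the copy `χ` only ports occur before the step, and the ports are disjoint from the
    -- names of the rule.
    fresh {x} x∈r = occ≡0⇒∉ (trans (cong (occurrences (copy χ x)) (names-before χ))
      (trans (occ-copy χ x ports (namesᵐ rest)) (occ-∉ ports λ x∈ → disjoint (x∈ , x∈r))))

  contradictory : ∀ {g h} → g ∈ ports → g ∈ namesᵐ Γ → h ∈ ports → h ∈ namesᵐ Δ →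
                  ∀ s′ → Step I s′ (beforeᶜ χ₁) → Step I s′ (beforeᶜ inΓ) → ⊥
  contradictory {g} {h} g∈ g∈Γ h∈ h∈Δ s′ =
    -- The three names are `code true g`, `code true h` and `code false h`. In the second
    -- configuration `inΓ` is true at `g` and false at `h`, so the active pair there contains
    -- `code true g` and `code false h`, while `code true h` is left to the other residual.
    no-common-predecessor I s′ (beforeᶜ χ₁) (beforeᶜ inΓ) free
      (Cooccur-before χ₁ g∈ h∈) (Separated-before χ₁ g h)
      (subst₂ (λ k l → Cooccur (code k g) (code l h) (before inΓ))
              (inΓ-true g∈Γ) (inΓ-false h∈Δ) (Cooccur-before inΓ g∈ h∈))
      (subst₂ (λ k l → Separated (code k g) (code l h) (before inΓ))
              (inΓ-true g∈Γ) (cong not (inΓ-false h∈Δ)) (Separated-before inΓ g h))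
    where
    free : ∀ {z} → z ∈ code true g ∷ code true h ∷ code false h ∷ [] → Free z (before χ₁) × Free z (before inΓ)
    free (here refl)                 = Free-before χ₁ true g∈ , Free-before inΓ true g∈
    free (there (here refl))         = Free-before χ₁ true h∈ , Free-before inΓ true h∈
    free (there (there (here refl))) = Free-before χ₁ false h∈ , Free-before inΓ false h∈
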